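{- Let $n$ be a large odd integer, let $d\ge1$ and $1\le k\le d$ be integers, and let $E\subset\mathbb{Z}_n^d$. Suppose that \[ |E| \gg \frac{\sqrt{\tau(n)}\, n^{d+\frac{k-1}{2}}}{\gamma(n)^{(d-1)/2}}. \] Then $E$ determines a positive proportion of all dot-product $k$-simplices, i.e. \[ |\mathcal{P}_k(E)| \gg n^{\binom{k+1}{2}}. \]
   Context: $\mathbb{Z}_n$ is the ring of residues modulo $n$. For $x,y\in\mathbb{Z}_n^d$, $x\cdot y=x_1y_1+\dots+x_dy_d$. $\gamma(n)$ is the smallest prime divisor of $n$ and $\tau(n)$ is the number of divisors of $n$. A tuple $l_k=(t_{i,j})_{0\le i<j\le k}\in\mathbb{Z}_n^{\binom{k+1}{2}}$ is a dot-product $k$-simplex type; the set of dot-product $k$-simplices determined by $E$ is $\mathcal{P}_k(E)=\{l_k : \exists\, x_0,\dots,x_k\in E \text{ with } x_i\cdot x_j=t_{i,j} \text{ for all } 0\le i<j\le k\}$. Notation: $X\gg Y$ means $X\ge CY$ for some constant $C>0$ independent of $n$ and $E$ (it may depend on $d,k$); a hypothesis $|E|\gg Y$ means $|E|\ge CY$ for a suitable sufficiently large such constant $C$. -}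

module Defs where

open import Data.Nat using (ℕ; zero; suc; _*_; _≤_; NonZero)
open import Data.Nat.DivMod using (_mod_)
open import Data.Nat.Divisibility using (_∣?_)
open import Data.Nat.Primality using (prime?)
open import Data.Fin using (Fin; toℕ; _<_)
open import Data.Fin.Properties using (_<?_)
open import Data.Vec using (Vec; zipWith; sum)
open import Data.List using (List; []; _∷_; length; filter; map; upTo; allFin; cartesianProduct; lookup)
open import Data.List.Membership.Propositional using (_∈_)
open import Data.Product using (_×_; _,_; proj₁; proj₂; Σ)
open import Relation.Nullary.Decidable using (_×-dec_)
open import Relation.Binary.PropositionalEquality using (_≡_)

Point : ℕ → ℕ → Set
Point n d = Vec (Fin n) d

dot : ∀ {n d} .{{_ : NonZero n}} → Point n d → Point n d → Fin n
dot x y = sum (zipWith (λ a b → toℕ a * toℕ b) x y) mod _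

τ : ℕ → ℕ
τ n = length (filter (λ m → m ∣? n) (map suc (upTo n)))

-- γ(n): smallest prime divisor of n (first m ∈ {0,…,n} that is prime and divides n;
-- default 1 when none exists, i.e. n ≤ 1, irrelevant for the theorem).
γ : ℕ → ℕ
γ n = first (filter (λ m → prime? m ×-dec (m ∣? n)) (upTo (suc n)))
  where
  first : List ℕ → ℕ
  first []      = 1
  first (m ∷ _) = m

pairs : (k : ℕ) → List (Fin (suc k) × Fin (suc k))
pairs k = filter (λ p → proj₁ p <? proj₂ p) (cartesianProduct (allFin (suc k)) (allFin (suc k)))

-- A dot-product k-simplex type l_k = (t_{i,j})_{0≤i<j≤k}: entry number q is t_{i,j}
-- where (i , j) is the q-th pair of `pairs k`.
SimplexType : ℕ → ℕ → Set
SimplexType n k = Vec (Fin n) (length (pairs k))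

InP : ∀ {n d} .{{_ : NonZero n}} (k : ℕ) → List (Point n d) → SimplexType n k → Set
InP {n} {d} k E t =
  Σ (Fin (suc k) → Point n d) λ x →
    ((i : Fin (suc k)) → x i ∈ E) ×
    ((q : Fin (length (pairs k))) →
      dot (x (proj₁ (lookup (pairs k) q))) (x (proj₂ (lookup (pairs k) q)))
        ≡ Data.Vec.lookup t q)

{-# OPTIONS --safe #-}

-- For a tuple X the energy of F is the number of pairs (y , z) in F × F with y·x = z·x
-- for all x in X.  For a single x running over all of ℤ_n^d, a pair (y , z) contributes
-- n^(d-1) gcd(n, y - z), and the gcd exceeds 1 only through divisors m ≥ γ(n) of n with
-- y ≡ z mod m; this replaces the character sum estimate.  Applying the bound to the fibers
-- {y ∈ F : y·x = t} and iterating gives n^k ∑_X energy(X) ≤ 2 |E|^(k+2), where X ranges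
-- over E^k.  By Cauchy–Schwarz, a tuple X of small energy sees many different stars
-- (y·x)_{x ∈ X} with y ∈ E.  Since this applies to the extensions of X inside any dense set
-- of (k+1)-tuples, induction on k produces simplices of pairwise distinct types: distinct
-- types of k-tuples, each extended by distinct stars, remain distinct.
module Submission where

open import Defs
open import Data.Bool using (true; false; if_then_else_)
open import Data.Nat using (ℕ; zero; suc; _+_; _*_; _∸_; _^_; _≤_; _<_; _≤?_; _<?_; _%_; _/_; NonZero; z≤n; s≤s; z<s; s<s; >-nonZero; ≢-nonZero⁻¹; >-nonZero⁻¹)
open import Data.Nat.Properties
open import Data.Nat.DivMod using (m≡m%n+[m/n]*n; m<n*o⇒m/o<n; %-remove-+ʳ)
open import Data.Nat.Divisibility using (_∣_; _∣?_; divides; ∣-refl; ∣-reflexive; ∣-trans; ∣⇒≤; 0∣⇒≡0; 1∣_; n∣m*n; *-cancelʳ-∣; quotient; m∣n⇒n≡quotient*m)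
open import Data.Nat.GCD using (gcd; gcd[m,n]∣m; gcd[m,n]∣n; gcd-greatest; c*gcd[m,n]≡gcd[cm,cn])
open import Data.Nat.ListAction using (product)
open import Data.Nat.Primality using (Prime; prime?)
open import Data.Nat.Primality.Factorisation using (factorise)
open import Data.Integer as ℤ using (ℤ; +_; ∣_∣)
import Data.Integer.Properties as ℤ
import Data.Integer.Divisibility.Signed as ℤ
import Data.Integer.Tactic.RingSolver as ℤ
open import Data.Nat.Combinatorics using (_C_; nC1≡n; nCk+nC[k+1]≡[n+1]C[k+1])
open import Data.Nat.Tactic.RingSolver using (solve-∀)
open import Data.Fin as Fin using (Fin; zero; suc; toℕ)
open import Data.Fin.Properties as Fin using (toℕ<n; toℕ-injective)
open import Data.Unit using (⊤; tt)
open import Data.List as List using (List; []; _∷_; _++_; length; map; filter; concatMap; take; cartesianProductWith; allFin; upTo)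
open import Data.List.Properties using (length-++; length-upTo; length-tabulate; length-filter; length-map)
open import Data.List.Membership.Propositional using (_∈_)
open import Data.List.Membership.Propositional.Properties
open import Data.List.Relation.Unary.Any as Any using (here; there)
import Data.List.Relation.Unary.Any.Properties as Any
open import Data.List.Relation.Unary.All as All using (All; []; _∷_)
import Data.List.Relation.Unary.All.Properties as All
open import Data.List.Relation.Binary.Sublist.Propositional using (_⊆_)
import Data.List.Relation.Binary.Sublist.Propositional.Properties as ⊆
open import Data.List.Relation.Unary.AllPairs as AllPairs using (AllPairs; []; _∷_)
import Data.List.Relation.Unary.AllPairs.Properties as AllPairs
open import Data.List.Relation.Unary.Unique.Propositional using (Unique)
open import Data.List.Relation.Unary.Unique.Propositional.Properties as Unique using (allFin⁺)
open import Data.Vec using (Vec; []; _∷_; zipWith)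
import Data.Vec as Vec
import Data.Vec.Properties as Vec
open import Data.Vec.Relation.Unary.All as VecAll using ([]; _∷_)
import Data.Vec.Relation.Unary.All.Properties as VecAll
open import Data.Product using (Σ; _×_; _,_; proj₁; proj₂)
open import Data.Sum using (inj₁; inj₂)
open import Function using (_∘_)
open import Relation.Nullary using (¬_; Dec; yes; no; does; contradiction)
open import Relation.Nullary.Decidable using (_×-dec_)
open import Relation.Binary.PropositionalEquality using (_≡_; refl; sym; trans; cong; cong₂; subst; module ≡-Reasoning)

-- Elementary inequalities and the two-term Cauchy-Schwarz inequality

four-mul≤sq : ∀ a b → 4 * (a * b) ≤ (a + b) * (a + b)
four-mul≤sq a b with ≤-total a b
... | inj₁ a≤b with δ , refl ← m≤n⇒∃[o]m+o≡n a≤b =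
      subst (4 * (a * (a + δ)) ≤_) (expand a δ) (m≤m+n _ (δ * δ))
  where
  expand : ∀ a δ → 4 * (a * (a + δ)) + δ * δ ≡ (a + (a + δ)) * (a + (a + δ))
  expand = solve-∀
... | inj₂ b≤a with δ , refl ← m≤n⇒∃[o]m+o≡n b≤a =
      subst (4 * ((b + δ) * b) ≤_) (expand b δ) (m≤m+n _ (δ * δ))
  where
  expand : ∀ b δ → 4 * ((b + δ) * b) + δ * δ ≡ ((b + δ) + b) * ((b + δ) + b)
  expand = solve-∀

sq-cancel-≤ : ∀ {a b} → a * a ≤ b * b → a ≤ b
sq-cancel-≤ {a} {b} a²≤b² with a ≤? b
... | yes a≤b = a≤b
... | no a≰b  = contradiction (*-mono-< (≰⇒> a≰b) (≰⇒> a≰b)) (≤⇒≯ a²≤b²)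

-- AM-GM in a form free of square roots: x is at most twice the geometric mean of a and b.
sq≤four-mul⇒≤+ : ∀ {x} a b → x * x ≤ 4 * (a * b) → x ≤ a + b
sq≤four-mul⇒≤+ a b x²≤4ab = sq-cancel-≤ (≤-trans x²≤4ab (four-mul≤sq a b))

-- Only the cross term 2ab needs an argument: its square is at most 4(rf)(se), so AM-GM bounds it by
-- rf + se.
+-cauchy-schwarz : ∀ a b r s e f → a * a ≤ r * e → b * b ≤ s * f →
                   (a + b) * (a + b) ≤ (r + s) * (e + f)
+-cauchy-schwarz a b r s e f a²≤re b²≤sf = begin
  (a + b) * (a + b)                   ≡⟨ lhs a b ⟩
  a * a + b * b + 2 * (a * b)         ≤⟨ +-mono-≤ (+-mono-≤ a²≤re b²≤sf) cross ⟩
  r * e + s * f + (r * f + s * e)     ≡⟨ rhs r s e f ⟩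
  (r + s) * (e + f)                   ∎
  where
  open ≤-Reasoning
  lhs : ∀ a b → (a + b) * (a + b) ≡ a * a + b * b + 2 * (a * b)
  lhs = solve-∀
  rhs : ∀ r s e f → r * e + s * f + (r * f + s * e) ≡ (r + s) * (e + f)
  rhs = solve-∀
  sq : ∀ a b → 2 * (a * b) * (2 * (a * b)) ≡ 4 * ((a * a) * (b * b))
  sq = solve-∀
  swap : ∀ r s e f → 4 * ((r * e) * (s * f)) ≡ 4 * ((r * f) * (s * e))
  swap = solve-∀
  cross : 2 * (a * b) ≤ r * f + s * e
  cross = sq≤four-mul⇒≤+ (r * f) (s * e) (begin
    2 * (a * b) * (2 * (a * b))   ≡⟨ sq a b ⟩
    4 * ((a * a) * (b * b))       ≤⟨ *-monoʳ-≤ 4 (*-mono-≤ a²≤re b²≤sf) ⟩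
    4 * ((r * e) * (s * f))       ≡⟨ swap r s e f ⟩
    4 * ((r * f) * (s * e))       ∎)

-- Finite sums

∑ : ∀ {a} {A : Set a} → List A → (A → ℕ) → ℕ
∑ []       f = 0
∑ (x ∷ xs) f = f x + ∑ xs f

infixr 5 ∑
syntax ∑ xs (λ x → e) = ∑[ x ∈ xs ] e

module _ {a} {A : Set a} where

  ∑-mono-∈ : ∀ xs {f g : A → ℕ} → (∀ {x} → x ∈ xs → f x ≤ g x) → ∑ xs f ≤ ∑ xs g
  ∑-mono-∈ []       f≤g = z≤n
  ∑-mono-∈ (x ∷ xs) f≤g = +-mono-≤ (f≤g (here refl)) (∑-mono-∈ xs (f≤g ∘ there))

  ∑-mono : ∀ xs {f g : A → ℕ} → (∀ x → f x ≤ g x) → ∑ xs f ≤ ∑ xs g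
  ∑-mono xs f≤g = ∑-mono-∈ xs (λ {x} _ → f≤g x)

  ∑-cong : ∀ xs {f g : A → ℕ} → (∀ x → f x ≡ g x) → ∑ xs f ≡ ∑ xs g
  ∑-cong []       f≗g = refl
  ∑-cong (x ∷ xs) f≗g = cong₂ _+_ (f≗g x) (∑-cong xs f≗g)

  ∑-+ : ∀ xs (f g : A → ℕ) → ∑[ x ∈ xs ] (f x + g x) ≡ ∑ xs f + ∑ xs g
  ∑-+ []       f g = refl
  ∑-+ (x ∷ xs) f g = trans (cong (λ s → f x + g x + s) (∑-+ xs f g))
                           (+-medial (f x) (g x) (∑ xs f) (∑ xs g))
    where
    +-medial : ∀ p q r s → p + q + (r + s) ≡ p + r + (q + s)
    +-medial = solve-∀

  ∑-*ˡ : ∀ c xs (f : A → ℕ) → ∑[ x ∈ xs ] c * f x ≡ c * ∑ xs f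
  ∑-*ˡ c []       f = sym (*-zeroʳ c)
  ∑-*ˡ c (x ∷ xs) f = trans (cong (λ s → c * f x + s) (∑-*ˡ c xs f)) (sym (*-distribˡ-+ c (f x) (∑ xs f)))

  ∑-*ʳ : ∀ c xs (f : A → ℕ) → ∑[ x ∈ xs ] f x * c ≡ ∑ xs f * c
  ∑-*ʳ c xs f = trans (∑-cong xs (λ x → *-comm (f x) c)) (trans (∑-*ˡ c xs f) (*-comm c (∑ xs f)))

  ∑-const : ∀ xs c → ∑ {A = A} xs (λ _ → c) ≡ length xs * c
  ∑-const []       c = refl
  ∑-const (x ∷ xs) c = cong (λ s → c + s) (∑-const xs c)

  ∑-1 : ∀ xs → ∑ {A = A} xs (λ _ → 1) ≡ length xs
  ∑-1 xs = trans (∑-const xs 1) (*-identityʳ (length xs))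

  ∑-++ : ∀ xs ys (f : A → ℕ) → ∑ (xs ++ ys) f ≡ ∑ xs f + ∑ ys f
  ∑-++ []       ys f = refl
  ∑-++ (x ∷ xs) ys f = trans (cong (λ s → f x + s) (∑-++ xs ys f)) (sym (+-assoc (f x) _ _))

  ∑-∈ : ∀ {x xs} (f : A → ℕ) → x ∈ xs → f x ≤ ∑ xs f
  ∑-∈ f (here refl)          = m≤m+n _ _
  ∑-∈ f (there {x = y} x∈xs) = ≤-trans (∑-∈ f x∈xs) (m≤n+m _ (f y))

  -- Cauchy–Schwarz, with the weights r x and e x standing for squares.
  ∑-cauchy-schwarz : ∀ xs (f r e : A → ℕ) → (∀ x → f x * f x ≤ r x * e x) →
                     ∑ xs f * ∑ xs f ≤ ∑ xs r * ∑ xs e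
  ∑-cauchy-schwarz []       f r e f²≤re = z≤n
  ∑-cauchy-schwarz (x ∷ xs) f r e f²≤re =
    +-cauchy-schwarz (f x) (∑ xs f) (r x) (∑ xs r) (e x) (∑ xs e)
      (f²≤re x) (∑-cauchy-schwarz xs f r e f²≤re)

module _ {a b} {A : Set a} {B : Set b} where

  ∑-swap : ∀ xs ys (f : A → B → ℕ) →
           ∑[ x ∈ xs ] ∑[ y ∈ ys ] f x y ≡ ∑[ y ∈ ys ] ∑[ x ∈ xs ] f x y
  ∑-swap []       ys f = sym (trans (∑-const ys 0) (*-zeroʳ (length ys)))
  ∑-swap (x ∷ xs) ys f = trans (cong (λ s → ∑ ys (f x) + s) (∑-swap xs ys f)) (sym (∑-+ ys (f x) _))

  ∑-*-∑ : ∀ xs ys (f : A → ℕ) (g : B → ℕ) →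
          ∑ xs f * ∑ ys g ≡ ∑[ x ∈ xs ] ∑[ y ∈ ys ] f x * g y
  ∑-*-∑ xs ys f g = trans (sym (∑-*ʳ (∑ ys g) xs f)) (∑-cong xs (λ x → sym (∑-*ˡ (f x) ys g)))

  ∑-map : ∀ (h : A → B) xs (f : B → ℕ) → ∑ (map h xs) f ≡ ∑ xs (f ∘ h)
  ∑-map h []       f = refl
  ∑-map h (x ∷ xs) f = cong (λ s → f (h x) + s) (∑-map h xs f)

  length-concatMap : ∀ (h : A → List B) xs → length (concatMap h xs) ≡ ∑ xs (length ∘ h)
  length-concatMap h []       = refl
  length-concatMap h (x ∷ xs) =
    trans (length-++ (h x)) (cong (λ s → length (h x) + s) (length-concatMap h xs))

-- Indicators and double counting

𝟙 : ∀ {p} {P : Set p} → Dec P → ℕ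
𝟙 P? = if does P? then 1 else 0

𝟙-≤1 : ∀ {p} {P : Set p} (P? : Dec P) → 𝟙 P? ≤ 1
𝟙-≤1 (yes _) = ≤-refl
𝟙-≤1 (no _)  = z≤n

𝟙-mono : ∀ {p q} {P : Set p} {Q : Set q} (P? : Dec P) (Q? : Dec Q) → (P → Q) → 𝟙 P? ≤ 𝟙 Q?
𝟙-mono (no _)  Q?      P⇒Q = z≤n
𝟙-mono (yes p) (yes _) P⇒Q = ≤-refl
𝟙-mono (yes p) (no ¬q) P⇒Q = contradiction (P⇒Q p) ¬q

𝟙-yes : ∀ {p} {P : Set p} (P? : Dec P) → P → 𝟙 P? ≡ 1
𝟙-yes (yes _) p = refl
𝟙-yes (no ¬p) p = contradiction p ¬p

𝟙-no : ∀ {p} {P : Set p} (P? : Dec P) → ¬ P → 𝟙 P? ≡ 0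
𝟙-no (yes p) ¬p = contradiction p ¬p
𝟙-no (no _)  ¬p = refl

𝟙-* : ∀ {p q} {P : Set p} {Q : Set q} (P? : Dec P) (Q? : Dec Q) → 𝟙 P? * 𝟙 Q? ≡ 𝟙 (P? ×-dec Q?)
𝟙-* (yes _) (yes _) = refl
𝟙-* (yes _) (no _)  = refl
𝟙-* (no _)  (yes _) = refl
𝟙-* (no _)  (no _)  = refl

𝟙*-≤ : ∀ {p} {P : Set p} (P? : Dec P) {m n} → (P → m ≤ n) → 𝟙 P? * m ≤ n
𝟙*-≤ (yes p) m≤n = ≤-trans (≤-reflexive (*-identityˡ _)) (m≤n p)
𝟙*-≤ (no _)  m≤n = z≤n

≤-𝟙* : ∀ {p} {P : Set p} (P? : Dec P) {m n} → (¬ P → m ≡ 0) → (P → m ≤ n) → m ≤ 𝟙 P? * n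
≤-𝟙* (yes p) m≡0 m≤n = ≤-trans (m≤n p) (≤-reflexive (sym (*-identityˡ _)))
≤-𝟙* (no ¬p) m≡0 m≤n = ≤-reflexive (m≡0 ¬p)

≤-+-*𝟙 : ∀ {p} {P : Set p} (P? : Dec P) {m a b} → (P → m ≤ a + b) → (¬ P → m ≤ a) → m ≤ a + b * 𝟙 P?
≤-+-*𝟙 (yes p) {b = b} m≤a+b m≤a rewrite *-identityʳ b = m≤a+b p
≤-+-*𝟙 (no ¬p) {b = b} m≤a+b m≤a = ≤-trans (m≤a ¬p) (m≤m+n _ (b * 0))

module _ {a p} {A : Set a} {P : A → Set p} (P? : ∀ x → Dec (P x)) where

  length-filter-∑ : ∀ xs → length (filter P? xs) ≡ ∑[ x ∈ xs ] 𝟙 (P? x)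
  length-filter-∑ []       = refl
  length-filter-∑ (x ∷ xs) with does (P? x)
  ... | true  = cong suc (length-filter-∑ xs)
  ... | false = length-filter-∑ xs

  ∑𝟙-none : ∀ xs → (∀ {x} → x ∈ xs → ¬ P x) → ∑[ x ∈ xs ] 𝟙 (P? x) ≡ 0
  ∑𝟙-none []       ¬P = refl
  ∑𝟙-none (x ∷ xs) ¬P = cong₂ _+_ (𝟙-no (P? x) (¬P (here refl))) (∑𝟙-none xs (¬P ∘ there))

  ∑𝟙-≤1 : ∀ {xs} → Unique xs → (∀ {x y} → P x → P y → x ≡ y) → ∑[ x ∈ xs ] 𝟙 (P? x) ≤ 1
  ∑𝟙-≤1 {[]}     []          P! = z≤n
  ∑𝟙-≤1 {x ∷ xs} (x∉xs ∷ u) P! with P? x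
  ... | yes px = ≤-reflexive (cong suc (∑𝟙-none xs (λ y∈xs py → All.lookup x∉xs y∈xs (P! px py))))
  ... | no _   = ∑𝟙-≤1 u P!

-- Double counting of the pairs x ≡ y: every entry of `xs` meets some entry of `ys`, and every entry
-- of `ys` is met at most once because `xs` is free of repetitions.
∑-⊆ : ∀ {a} {A : Set a} (_≟_ : (x y : A) → Dec (x ≡ y)) {xs ys : List A} (f : A → ℕ) →
      Unique xs → (∀ {x} → x ∈ xs → x ∈ ys) → ∑ xs f ≤ ∑ ys f
∑-⊆ _≟_ {xs} {ys} f u xs⊆ys = begin
  ∑ xs f                                       ≤⟨ ∑-mono-∈ xs (λ {x} x∈xs → ≤-trans
                                                     (≤-reflexive (sym (trans (cong (_* f x) (𝟙-yes (x ≟ x) refl)) (*-identityˡ (f x)))))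
                                                     (∑-∈ (λ y → 𝟙 (x ≟ y) * f y) (xs⊆ys x∈xs))) ⟩
  ∑[ x ∈ xs ] ∑[ y ∈ ys ] 𝟙 (x ≟ y) * f y    ≡⟨ ∑-swap xs ys _ ⟩
  ∑[ y ∈ ys ] ∑[ x ∈ xs ] 𝟙 (x ≟ y) * f y    ≡⟨ ∑-cong ys (λ y → ∑-*ʳ (f y) xs _) ⟩
  (∑[ y ∈ ys ] (∑[ x ∈ xs ] 𝟙 (x ≟ y)) * f y) ≤⟨ ∑-mono ys (λ y → *-monoˡ-≤ (f y)
                                                     (∑𝟙-≤1 (_≟ y) u (λ p q → trans p (sym q)))) ⟩
  ∑[ y ∈ ys ] 1 * f y                          ≡⟨ ∑-cong ys (λ y → *-identityˡ (f y)) ⟩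
  ∑ ys f                                        ∎
  where open ≤-Reasoning

-- Tuples over a list

vecs : ∀ {a} {A : Set a} → List A → ∀ k → List (Vec A k)
vecs xs zero    = [] ∷ []
vecs xs (suc k) = cartesianProductWith _∷_ xs (vecs xs k)

module _ {a} {A : Set a} (xs : List A) where

  ∑-vecs-suc : ∀ k (f : Vec A (suc k) → ℕ) →
               ∑ (vecs xs (suc k)) f ≡ ∑[ x ∈ xs ] ∑[ v ∈ vecs xs k ] f (x ∷ v)
  ∑-vecs-suc k f = go xs
    where
    go : ∀ ys → ∑ (cartesianProductWith _∷_ ys (vecs xs k)) f ≡ ∑[ x ∈ ys ] ∑[ v ∈ vecs xs k ] f (x ∷ v)
    go []       = refl
    go (y ∷ ys) = trans (∑-++ (map (y ∷_) (vecs xs k)) _ f)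
                        (cong₂ _+_ (∑-map (y ∷_) (vecs xs k) f) (go ys))

  length-vecs : ∀ k → length (vecs xs k) ≡ length xs ^ k
  length-vecs zero    = refl
  length-vecs (suc k) = begin
    length (vecs xs (suc k))              ≡⟨ ∑-1 (vecs xs (suc k)) ⟨
    ∑ (vecs xs (suc k)) (λ _ → 1)         ≡⟨ ∑-vecs-suc k (λ _ → 1) ⟩
    ∑ xs (λ _ → ∑ (vecs xs k) (λ _ → 1))  ≡⟨ ∑-const xs _ ⟩
    length xs * ∑ (vecs xs k) (λ _ → 1)   ≡⟨ cong (length xs *_) (trans (∑-1 (vecs xs k)) (length-vecs k)) ⟩
    length xs ^ suc k                     ∎
    where open ≡-Reasoning

  vecs-complete : ∀ {k} (v : Vec A k) → (∀ x → x ∈ xs) → v ∈ vecs xs k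
  vecs-complete []      all∈ = here refl
  vecs-complete (x ∷ v) all∈ = ∈-cartesianProductWith⁺ _∷_ (all∈ x) (vecs-complete v all∈)

-- The smallest prime divisor

γ≤prime : ∀ {n p} .{{_ : NonZero n}} → Prime p → p ∣ n → γ n ≤ p
γ≤prime {n} {p} p-prime p∣n
  with filter (λ m → prime? m ×-dec (m ∣? n)) (upTo (suc n))
     | ∈-filter⁺ (λ m → prime? m ×-dec (m ∣? n)) (∈-upTo⁺ (s≤s (∣⇒≤ p∣n))) (p-prime , p∣n)
     -- Filtering keeps the candidates in increasing order, so the head, which is the value of `γ`,
     -- is at most every later entry.
     | AllPairs.filter⁺ (λ m → prime? m ×-dec (m ∣? n)) (AllPairs.applyUpTo⁺₁ (λ i → i) (suc n) (λ i<j _ → <⇒≤ i<j))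
... | q ∷ qs | here refl    | _         = ≤-refl
... | q ∷ qs | there p∈qs | q≤qs ∷ _ = All.lookup q≤qs p∈qs

γ≤divisor : ∀ {n m} .{{_ : NonZero n}} → 1 < m → m ∣ n → γ n ≤ m
γ≤divisor {n} {m} 1<m m∣n with factorise m {{>-nonZero (<-trans z<s 1<m)}}
... | record { factors = [] ; isFactorisation = m≡1 } = contradiction (sym m≡1) (<⇒≢ 1<m)
... | record { factors = p ∷ ps ; isFactorisation = m≡p*ps ; factorsPrime = p-prime ∷ _ } =
  ≤-trans (γ≤prime p-prime (∣-trans p∣m m∣n)) (∣⇒≤ {{>-nonZero (<-trans z<s 1<m)}} p∣m)
  where
  p∣m : p ∣ m
  p∣m = divides (product ps) (trans m≡p*ps (*-comm p (product ps)))

-- Residue classes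

%-≡⇒∣- : ∀ {r} .{{_ : NonZero r}} a b → a % r ≡ b % r → + r ℤ.∣ + a ℤ.- + b
%-≡⇒∣- {r} a b eq = ℤ.divides (+ (a / r) ℤ.- + (b / r)) (begin
  + a ℤ.- + b                                           ≡⟨ cong₂ ℤ._-_ (split a) (split b) ⟩
  (+ (a % r) ℤ.+ + (a / r) ℤ.* + r) ℤ.- (+ (b % r) ℤ.+ + (b / r) ℤ.* + r)
                                                        ≡⟨ cong (λ u → (+ u ℤ.+ + (a / r) ℤ.* + r) ℤ.- (+ (b % r) ℤ.+ + (b / r) ℤ.* + r)) eq ⟩
  (+ (b % r) ℤ.+ + (a / r) ℤ.* + r) ℤ.- (+ (b % r) ℤ.+ + (b / r) ℤ.* + r)
                                                        ≡⟨ cancel (+ (b % r)) (+ (a / r)) (+ (b / r)) (+ r) ⟩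
  (+ (a / r) ℤ.- + (b / r)) ℤ.* + r                     ∎)
  where
  open ≡-Reasoning
  split : ∀ c → + c ≡ + (c % r) ℤ.+ + (c / r) ℤ.* + r
  split c = trans (cong +_ (m≡m%n+[m/n]*n c r)) (cong (λ u → + (c % r) ℤ.+ u) (ℤ.pos-* (c / r) r))
  cancel : ∀ u v w x → (u ℤ.+ v ℤ.* x) ℤ.- (u ℤ.+ w ℤ.* x) ≡ (v ℤ.- w) ℤ.* x
  cancel = ℤ.solve-∀

∣-⇒%-≡ : ∀ {r} .{{_ : NonZero r}} a b → + r ℤ.∣ + a ℤ.- + b → a % r ≡ b % r
∣-⇒%-≡ {r} a b r∣a-b with ≤-total a b
... | inj₁ a≤b with δ , refl ← m≤n⇒∃[o]m+o≡n a≤b = sym (%-remove-+ʳ a r∣δ)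
  where
  cancel : ∀ x y → x ℤ.- (x ℤ.+ y) ≡ ℤ.- y
  cancel = ℤ.solve-∀
  r∣δ : r ∣ δ
  r∣δ = subst (r ∣_) (trans (cong ∣_∣ (cancel (+ a) (+ δ))) (ℤ.∣-i∣≡∣i∣ (+ δ))) (ℤ.∣⇒∣ᵤ r∣a-b)
... | inj₂ b≤a with δ , refl ← m≤n⇒∃[o]m+o≡n b≤a = %-remove-+ʳ b r∣δ
  where
  cancel : ∀ x y → (x ℤ.+ y) ℤ.- x ≡ y
  cancel = ℤ.solve-∀
  r∣δ : r ∣ δ
  r∣δ = subst (r ∣_) (cong ∣_∣ (cancel (+ b) (+ δ))) (ℤ.∣⇒∣ᵤ r∣a-b)

-- The quotient by r separates the elements of one residue class modulo r.
residue-class-size : ∀ {r n} .{{_ : NonZero r}} → r ∣ n → {P : Fin n → Set} (P? : ∀ a → Dec (P a)) →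
                     (∀ {a b} → P a → P b → + r ℤ.∣ + toℕ a ℤ.- + toℕ b) →
                     (∑[ a ∈ allFin n ] 𝟙 (P? a)) * r ≤ n
residue-class-size {r} (divides q refl) {P} P? congruent = *-monoˡ-≤ r (begin
  ∑[ a ∈ as ] 𝟙 (P? a)                                   ≤⟨ ∑-mono as quotient-exists ⟩
  ∑[ a ∈ as ] ∑[ t ∈ upTo q ] 𝟙 (R? t a)               ≡⟨ ∑-swap as (upTo q) _ ⟩
  ∑[ t ∈ upTo q ] ∑[ a ∈ as ] 𝟙 (R? t a)               ≤⟨ ∑-mono (upTo q) (λ t → ∑𝟙-≤1 (R? t) (allFin⁺ _) R-unique) ⟩
  ∑[ t ∈ upTo q ] 1                                       ≡⟨ ∑-1 (upTo q) ⟩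
  length (upTo q)                                         ≡⟨ length-upTo q ⟩
  q                                                       ∎)
  where
  open ≤-Reasoning
  as = allFin (q * r)
  R? : ∀ t a → Dec (P a × toℕ a / r ≡ t)
  R? t a = P? a ×-dec (toℕ a / r ≟ t)
  quotient-exists : ∀ a → 𝟙 (P? a) ≤ ∑[ t ∈ upTo q ] 𝟙 (R? t a)
  quotient-exists a = ≤-trans (𝟙-mono (P? a) (R? _ a) (_, refl))
    (∑-∈ (λ t → 𝟙 (R? t a)) (∈-upTo⁺ (m<n*o⇒m/o<n {n = q} (toℕ<n a))))
  R-unique : ∀ {t a b} → P a × toℕ a / r ≡ t → P b × toℕ b / r ≡ t → a ≡ b
  R-unique {a = a} {b} (pa , a/r≡t) (pb , b/r≡t) = toℕ-injective (begin-equality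
    toℕ a                           ≡⟨ m≡m%n+[m/n]*n (toℕ a) r ⟩
    toℕ a % r + toℕ a / r * r       ≡⟨ cong₂ (λ u v → u + v * r) (∣-⇒%-≡ (toℕ a) (toℕ b) (congruent pa pb)) (trans a/r≡t (sym b/r≡t)) ⟩
    toℕ b % r + toℕ b / r * r       ≡⟨ m≡m%n+[m/n]*n (toℕ b) r ⟨
    toℕ b                           ∎)
-- Linear congruences

linear : ∀ {n d} → Vec ℤ d → Point n d → ℤ
linear []       []       = + 0
linear (w ∷ ws) (x ∷ xs) = w ℤ.* + toℕ x ℤ.+ linear ws xs

-- The gcd is folded from the tail because `linear-solutions` first eliminates the tail variables
-- modulo m and then the head variable modulo the gcd that remains.
gcds : ∀ {d} → ℕ → Vec ℤ d → ℕ
gcds m []       = m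
gcds m (w ∷ ws) = gcd (gcds m ws) ∣ w ∣

gcds∣m : ∀ {d} m (ws : Vec ℤ d) → gcds m ws ∣ m
gcds∣m m []       = ∣-refl
gcds∣m m (w ∷ ws) = ∣-trans (gcd[m,n]∣m (gcds m ws) ∣ w ∣) (gcds∣m m ws)

gcds∣ws : ∀ {d} m (ws : Vec ℤ d) → VecAll.All (λ w → + gcds m ws ℤ.∣ w) ws
gcds∣ws m []       = []
gcds∣ws m (w ∷ ws) = ℤ.∣ᵤ⇒∣ (gcd[m,n]∣n (gcds m ws) ∣ w ∣)
  ∷ VecAll.map (ℤ.∣-trans (ℤ.∣ᵤ⇒∣ (gcd[m,n]∣m (gcds m ws) ∣ w ∣))) (gcds∣ws m ws)

∣-nonZero : ∀ {m n} .{{_ : NonZero n}} → m ∣ n → NonZero m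
∣-nonZero {zero}  {suc n} (divides q eq) = contradiction (trans eq (*-zeroʳ q)) λ ()
∣-nonZero {suc m} _ = _

-- With h = gcd(g, w), g divides both xg and xw, hence xh. Cancelling h from g = rh leaves r
-- dividing x, without a detour through coprimality.
∣*⇒/gcd∣ : ∀ {g r x} .{{_ : NonZero g}} w → g ≡ r * gcd g ∣ w ∣ → + g ℤ.∣ w ℤ.* x → + r ℤ.∣ x
∣*⇒/gcd∣ {g} {r} {x} w g≡rh g∣wx = ℤ.∣ᵤ⇒∣ (*-cancelʳ-∣ h {{h≢0}} (∣-trans (∣-reflexive (sym g≡rh)) g∣xh))
  where
  h = gcd g ∣ w ∣
  h≢0 : NonZero h
  h≢0 = ∣-nonZero (gcd[m,n]∣m g ∣ w ∣)
  g∣xw : g ∣ ∣ x ∣ * ∣ w ∣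
  g∣xw = subst (g ∣_) (trans (ℤ.abs-* w x) (*-comm ∣ w ∣ ∣ x ∣)) (ℤ.∣⇒∣ᵤ g∣wx)
  g∣xh : g ∣ ∣ x ∣ * h
  g∣xh = subst (g ∣_) (sym (c*gcd[m,n]≡gcd[cm,cn] (∣ x ∣) g (∣ w ∣))) (gcd-greatest (n∣m*n ∣ x ∣) g∣xw)

-- With h = gcd(g, w), a solution forces h to divide c, and two solutions differ by a multiple of
-- g/h. So there are at most nh/g of them; the factor g on the left avoids the division.
linear-solutions₁ : ∀ {n g} .{{_ : NonZero n}} → g ∣ n → ∀ w c →
  (∑[ a ∈ allFin n ] 𝟙 (+ g ℤ.∣? (w ℤ.* + toℕ a ℤ.+ c))) * g ≤
  𝟙 (+ gcd g ∣ w ∣ ℤ.∣? c) * (n * gcd g ∣ w ∣)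
linear-solutions₁ {n} {g} g∣n w c = ≤-𝟙* (+ gcd g ∣ w ∣ ℤ.∣? c)
  (λ h∤c → cong (_* g) (∑𝟙-none (λ a → + g ℤ.∣? (w ℤ.* + toℕ a ℤ.+ c)) (allFin n) (unsolvable h∤c)))
  (λ _ → begin
    #sol * g       ≡⟨ cong (#sol *_) g≡rh ⟩
    #sol * (r * h) ≡⟨ *-assoc #sol r h ⟨
    #sol * r * h   ≤⟨ *-monoˡ-≤ h (residue-class-size r∣n (λ a → + g ℤ.∣? (w ℤ.* + toℕ a ℤ.+ c)) congruent) ⟩
    n * h          ∎)
  where
  open ≤-Reasoning
  h = gcd g ∣ w ∣
  #sol = ∑[ a ∈ allFin n ] 𝟙 (+ g ℤ.∣? (w ℤ.* + toℕ a ℤ.+ c))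
  r = quotient (gcd[m,n]∣m g ∣ w ∣)
  g≡rh : g ≡ r * h
  g≡rh = m∣n⇒n≡quotient*m (gcd[m,n]∣m g ∣ w ∣)
  instance g≢0 : NonZero g
  g≢0 = ∣-nonZero g∣n
  r∣n : r ∣ n
  r∣n = ∣-trans (divides h (trans g≡rh (*-comm r h))) g∣n
  instance r≢0 : NonZero r
  r≢0 = ∣-nonZero r∣n
  unsolvable : ¬ (+ h ℤ.∣ c) → ∀ {a} → a ∈ allFin n → ¬ (+ g ℤ.∣ w ℤ.* + toℕ a ℤ.+ c)
  unsolvable h∤c {a} _ g∣wa+c = h∤c (ℤ.∣m+n∣m⇒∣n
    (ℤ.∣-trans (ℤ.∣ᵤ⇒∣ (gcd[m,n]∣m g ∣ w ∣)) g∣wa+c)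
    (ℤ.∣m⇒∣m*n {m = w} (+ toℕ a) (ℤ.∣ᵤ⇒∣ (gcd[m,n]∣n g ∣ w ∣))))
  factor : ∀ w x y c → (w ℤ.* x ℤ.+ c) ℤ.- (w ℤ.* y ℤ.+ c) ≡ w ℤ.* (x ℤ.- y)
  factor = ℤ.solve-∀
  congruent : ∀ {a b} → + g ℤ.∣ w ℤ.* + toℕ a ℤ.+ c → + g ℤ.∣ w ℤ.* + toℕ b ℤ.+ c →
              + r ℤ.∣ + toℕ a ℤ.- + toℕ b
  congruent {a} {b} p q = ∣*⇒/gcd∣ w g≡rh
    (subst (+ g ℤ.∣_) (factor w (+ toℕ a) (+ toℕ b) c) (ℤ.∣m∣n⇒∣m-n p q))

-- Induction on the number of variables. Once the head a is fixed, wa joins the constant, and the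
-- indicator in the induction hypothesis turns solvability of the tail into a one-variable
-- congruence for a. This is why the bound carries an indicator and an arbitrary constant c.
linear-solutions : ∀ {n m} .{{_ : NonZero n}} → m ∣ n → ∀ {d} (w : Vec ℤ d) c →
  (∑[ x ∈ vecs (allFin n) d ] 𝟙 (+ m ℤ.∣? (linear w x ℤ.+ c))) * m ≤
  𝟙 (+ gcds m w ℤ.∣? c) * (n ^ d * gcds m w)
linear-solutions {n} {m} m∣n [] c = ≤-reflexive (begin-equality
  (𝟙 (+ m ℤ.∣? (+ 0 ℤ.+ c)) + 0) * m ≡⟨ cong (λ z → (𝟙 (+ m ℤ.∣? z) + 0) * m) (ℤ.+-identityˡ c) ⟩
  (𝟙 (+ m ℤ.∣? c) + 0) * m           ≡⟨ cong (_* m) (+-identityʳ (𝟙 (+ m ℤ.∣? c))) ⟩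
  𝟙 (+ m ℤ.∣? c) * m                 ≡⟨ cong (𝟙 (+ m ℤ.∣? c) *_) (*-identityˡ m) ⟨
  𝟙 (+ m ℤ.∣? c) * (1 * m)           ∎)
  where open ≤-Reasoning
linear-solutions {n} {m} m∣n {suc d} (w ∷ ws) c = begin
  (∑[ x ∈ vecs (allFin n) (suc d) ] 𝟙 (+ m ℤ.∣? (linear (w ∷ ws) x ℤ.+ c))) * m
    ≡⟨ cong (_* m) (∑-vecs-suc (allFin n) d _) ⟩
  (∑[ a ∈ allFin n ] ∑[ x ∈ vecs (allFin n) d ] 𝟙 (+ m ℤ.∣? ((w ℤ.* + toℕ a ℤ.+ linear ws x) ℤ.+ c))) * m
    ≡⟨ cong (_* m) (∑-cong (allFin n) λ a → ∑-cong (vecs (allFin n) d) λ x →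
         cong (λ z → 𝟙 (+ m ℤ.∣? z)) (rearrange (w ℤ.* + toℕ a) (linear ws x) c)) ⟩
  (∑[ a ∈ allFin n ] ∑[ x ∈ vecs (allFin n) d ] 𝟙 (+ m ℤ.∣? (linear ws x ℤ.+ (w ℤ.* + toℕ a ℤ.+ c)))) * m
    ≡⟨ ∑-*ʳ m (allFin n) _ ⟨
  (∑[ a ∈ allFin n ] (∑[ x ∈ vecs (allFin n) d ] 𝟙 (+ m ℤ.∣? (linear ws x ℤ.+ (w ℤ.* + toℕ a ℤ.+ c)))) * m)
    ≤⟨ ∑-mono (allFin n) (λ a → linear-solutions m∣n ws (w ℤ.* + toℕ a ℤ.+ c)) ⟩
  (∑[ a ∈ allFin n ] 𝟙 (+ g ℤ.∣? (w ℤ.* + toℕ a ℤ.+ c)) * (n ^ d * g))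
    ≡⟨ ∑-*ʳ (n ^ d * g) (allFin n) _ ⟩
  #sol * (n ^ d * g)
    ≡⟨ shift #sol (n ^ d) g ⟩
  n ^ d * (#sol * g)
    ≤⟨ *-monoʳ-≤ (n ^ d) (linear-solutions₁ (∣-trans (gcds∣m m ws) m∣n) w c) ⟩
  n ^ d * (𝟙 (+ h ℤ.∣? c) * (n * h))
    ≡⟨ regroup (n ^ d) (𝟙 (+ h ℤ.∣? c)) n h ⟩
  𝟙 (+ h ℤ.∣? c) * (n ^ suc d * h) ∎
  where
  open ≤-Reasoning
  g = gcds m ws
  h = gcd g ∣ w ∣
  #sol = ∑[ a ∈ allFin n ] 𝟙 (+ g ℤ.∣? (w ℤ.* + toℕ a ℤ.+ c))
  rearrange : ∀ u v c → (u ℤ.+ v) ℤ.+ c ≡ v ℤ.+ (u ℤ.+ c)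
  rearrange = ℤ.solve-∀
  shift : ∀ s p g → s * (p * g) ≡ p * (s * g)
  shift = solve-∀
  regroup : ∀ p i n h → p * (i * (n * h)) ≡ i * (n * p * h)
  regroup = solve-∀
-- Points congruent to a given point

differences : ∀ {n d} → Point n d → Point n d → Vec ℤ d
differences = zipWith (λ a b → + toℕ a ℤ.- + toℕ b)

congruent? : ∀ r {n d} (y z : Point n d) → Dec (VecAll.All (+ r ℤ.∣_) (differences y z))
congruent? r y z = VecAll.all? (+ r ℤ.∣?_) (differences y z)

points : ∀ n d → List (Point n d)
points n = vecs (allFin n)

∈-points : ∀ {n d} (x : Point n d) → x ∈ points n d
∈-points x = vecs-complete (allFin _) x ∈-allFin

module _ {n r : ℕ} .{{_ : NonZero n}} (r∣n : r ∣ n) where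

  residue-class-sizeᶠ : ∀ (y : Fin n) → (∑[ a ∈ allFin n ] 𝟙 (+ r ℤ.∣? (+ toℕ y ℤ.- + toℕ a))) * r ≤ n
  residue-class-sizeᶠ y = residue-class-size {{∣-nonZero r∣n}} r∣n (λ a → + r ℤ.∣? (+ toℕ y ℤ.- + toℕ a))
    (λ {a} {b} p q → subst (+ r ℤ.∣_) (cancel (+ toℕ y) (+ toℕ a) (+ toℕ b)) (ℤ.∣m∣n⇒∣m-n q p))
    where
    cancel : ∀ y a b → (y ℤ.- b) ℤ.- (y ℤ.- a) ≡ a ℤ.- b
    cancel = ℤ.solve-∀

  -- Congruence is coordinatewise, so the count factors over the coordinates, each of which
  -- contributes at most n/r.
  congruence-class-size : ∀ {d} (y : Point n d) →
                          (∑[ z ∈ points n d ] 𝟙 (congruent? r y z)) * r ^ d ≤ n ^ d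
  congruence-class-size []                = ≤-refl
  congruence-class-size {suc d} (y ∷ ys) = begin
    (∑[ z ∈ points n (suc d) ] 𝟙 (congruent? r (y ∷ ys) z)) * r ^ suc d
      ≡⟨ cong (_* r ^ suc d) (∑-vecs-suc (allFin n) d _) ⟩
    (∑[ a ∈ allFin n ] ∑[ z ∈ points n d ] 𝟙 (congruent? r (y ∷ ys) (a ∷ z))) * r ^ suc d
      ≤⟨ *-monoˡ-≤ (r ^ suc d) (∑-mono (allFin n) λ a → ∑-mono (points n d) λ z → split a z) ⟩
    (∑[ a ∈ allFin n ] ∑[ z ∈ points n d ] head a * tail z) * r ^ suc d
      ≡⟨ cong (_* r ^ suc d) (∑-*-∑ (allFin n) (points n d) head tail) ⟨
    ∑ (allFin n) head * ∑ (points n d) tail * (r * r ^ d)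
      ≡⟨ [m*n]*[o*p]≡[m*o]*[n*p] (∑ (allFin n) head) (∑ (points n d) tail) r (r ^ d) ⟩
    (∑ (allFin n) head * r) * (∑ (points n d) tail * r ^ d)
      ≤⟨ *-mono-≤ (residue-class-sizeᶠ y) (congruence-class-size ys) ⟩
    n ^ suc d ∎
    where
    open ≤-Reasoning
    head : Fin n → ℕ
    head a = 𝟙 (+ r ℤ.∣? (+ toℕ y ℤ.- + toℕ a))
    tail : Point n d → ℕ
    tail z = 𝟙 (congruent? r ys z)
    split : ∀ a z → 𝟙 (congruent? r (y ∷ ys) (a ∷ z)) ≤ head a * tail z
    split a z = ≤-trans
      (𝟙-mono (congruent? r (y ∷ ys) (a ∷ z)) ((+ r ℤ.∣? (+ toℕ y ℤ.- + toℕ a)) ×-dec congruent? r ys z) VecAll.uncons)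
      (≤-reflexive (sym (𝟙-* (+ r ℤ.∣? (+ toℕ y ℤ.- + toℕ a)) (congruent? r ys z))))

-- Divisors and sums of gcds

-- The list is written exactly as in `τ`, so that its length is `τ n` by definition.
divisors : ℕ → List ℕ
divisors n = filter (λ m → m ∣? n) (map suc (upTo n))

∈-divisors⁺ : ∀ {m n} .{{_ : NonZero n}} → m ∣ n → m ∈ divisors n
∈-divisors⁺ {zero}  {n} 0∣n = contradiction (0∣⇒≡0 0∣n) (≢-nonZero⁻¹ n)
∈-divisors⁺ {suc m} {n} m∣n = ∈-filter⁺ (λ m → m ∣? n) (∈-map⁺ suc (∈-upTo⁺ (∣⇒≤ m∣n))) m∣n

∈-divisors⁻ : ∀ {m n} → m ∈ divisors n → m ∣ n
∈-divisors⁻ {m} {n} m∈ = proj₂ (∈-filter⁻ (λ m → m ∣? n) {xs = map suc (upTo n)} m∈)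

-- A gcd above 1 is itself one of the divisors m in the sum, and its own term already equals it; the
-- summand 1 covers the trivial gcd. Leaving out m = 1 is what later allows m to be compared with
-- γ(n).
gcds-≤-∑ : ∀ {n d} .{{_ : NonZero n}} (ws : Vec ℤ d) →
  gcds n ws ≤ 1 + (∑[ m ∈ divisors n ] 𝟙 (1 <? m) * (𝟙 (VecAll.all? (+ m ℤ.∣?_) ws) * m))
gcds-≤-∑ {n} ws with 1 <? gcds n ws
... | no g≤1  = ≤-trans (≮⇒≥ g≤1) (m≤m+n 1 _)
... | yes 1<g = begin
  g           ≡⟨ trans (cong₂ (λ u v → u * (v * g)) (𝟙-yes (1 <? g) 1<g)
                         (𝟙-yes (VecAll.all? (+ g ℤ.∣?_) ws) (gcds∣ws n ws)))
                       (trans (*-identityˡ (1 * g)) (*-identityˡ g)) ⟨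
  term g      ≤⟨ ∑-∈ term (∈-divisors⁺ (gcds∣m n ws)) ⟩
  ∑ (divisors n) term    ≤⟨ m≤n+m _ 1 ⟩
  1 + ∑ (divisors n) term ∎
  where
  open ≤-Reasoning
  g = gcds n ws
  term : ℕ → ℕ
  term m = 𝟙 (1 <? m) * (𝟙 (VecAll.all? (+ m ℤ.∣?_) ws) * m)

_≟ᵖ_ : ∀ {n d} (x y : Point n d) → Dec (x ≡ y)
_≟ᵖ_ = Vec.≡-dec Fin._≟_

∑-≤-points : ∀ {n d} {F : List (Point n d)} (f : Point n d → ℕ) → Unique F → ∑ F f ≤ ∑ (points n d) f
∑-≤-points f u = ∑-⊆ _≟ᵖ_ f u (λ _ → ∈-points _)

-- In dimension d + 1, the points congruent to y modulo a divisor m > 1 number at most (n/m)^(d+1).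
-- Weighted by m they contribute at most n^(d+1)/m^d, hence at most n^(d+1)/γ(n)^d, for each of the
-- τ(n) divisors. The term with `length F` comes from the summand 1 in `gcds-≤-∑`.
∑-gcds-≤ : ∀ {n d} .{{_ : NonZero n}} {F : List (Point n (suc d))} → Unique F → ∀ y →
  γ n ^ d * (∑[ z ∈ F ] gcds n (differences y z)) ≤ γ n ^ d * length F + τ n * n ^ suc d
∑-gcds-≤ {n} {d} {F} u y = begin
  G * (∑[ z ∈ F ] gcds n (differences y z))
    ≤⟨ *-monoʳ-≤ G (∑-mono F (λ z → gcds-≤-∑ (differences y z))) ⟩
  G * (∑[ z ∈ F ] (1 + (∑[ m ∈ divisors n ] term m z)))
    ≡⟨ cong (G *_) (∑-+ F (λ _ → 1) _) ⟩
  G * (∑ F (λ _ → 1) + (∑[ z ∈ F ] ∑[ m ∈ divisors n ] term m z))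
    ≡⟨ cong₂ (λ u v → G * (u + v)) (∑-1 F) (∑-swap F (divisors n) (λ z m → term m z)) ⟩
  G * (length F + (∑[ m ∈ divisors n ] ∑[ z ∈ F ] term m z))
    ≡⟨ *-distribˡ-+ G (length F) _ ⟩
  G * length F + G * (∑[ m ∈ divisors n ] ∑[ z ∈ F ] term m z)
    ≡⟨ cong (λ s → G * length F + s) (∑-*ˡ G (divisors n) _) ⟨
  G * length F + (∑[ m ∈ divisors n ] G * (∑[ z ∈ F ] term m z))
    ≤⟨ +-monoʳ-≤ (G * length F) (∑-mono-∈ (divisors n) (λ m∈ → divisor-bound (∈-divisors⁻ m∈))) ⟩
  G * length F + ∑ (divisors n) (λ _ → n ^ suc d)
    ≡⟨ cong (λ s → G * length F + s) (∑-const (divisors n) (n ^ suc d)) ⟩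
  G * length F + τ n * n ^ suc d ∎
  where
  open ≤-Reasoning
  G = γ n ^ d
  term : ℕ → Point n (suc d) → ℕ
  term m z = 𝟙 (1 <? m) * (𝟙 (congruent? m y z) * m)
  regroup : ∀ p c m → p * (c * m) ≡ c * (m * p)
  regroup = solve-∀
  divisor-bound : ∀ {m} → m ∣ n → G * (∑[ z ∈ F ] term m z) ≤ n ^ suc d
  divisor-bound {m} m∣n = begin
    G * (∑[ z ∈ F ] term m z)                               ≡⟨ cong (G *_) (∑-*ˡ (𝟙 (1 <? m)) F _) ⟩
    G * (𝟙 (1 <? m) * (∑[ z ∈ F ] 𝟙 (congruent? m y z) * m)) ≡⟨ cong (λ s → G * (𝟙 (1 <? m) * s)) (∑-*ʳ m F _) ⟩
    G * (𝟙 (1 <? m) * ((∑[ z ∈ F ] 𝟙 (congruent? m y z)) * m)) ≡⟨ swap-* G (𝟙 (1 <? m)) _ ⟩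
    𝟙 (1 <? m) * (G * ((∑[ z ∈ F ] 𝟙 (congruent? m y z)) * m)) ≤⟨ 𝟙*-≤ (1 <? m) nontrivial-bound ⟩
    n ^ suc d                                                ∎
    where
    swap-* : ∀ p q r → p * (q * r) ≡ q * (p * r)
    swap-* = solve-∀
    nontrivial-bound : 1 < m → G * ((∑[ z ∈ F ] 𝟙 (congruent? m y z)) * m) ≤ n ^ suc d
    nontrivial-bound 1<m = begin
      G * ((∑[ z ∈ F ] 𝟙 (congruent? m y z)) * m)
        ≤⟨ *-mono-≤ (^-monoˡ-≤ d (γ≤divisor 1<m m∣n)) (*-monoˡ-≤ m (∑-≤-points _ u)) ⟩
      m ^ d * ((∑[ z ∈ points n (suc d) ] 𝟙 (congruent? m y z)) * m)
        ≡⟨ regroup (m ^ d) (∑[ z ∈ points n (suc d) ] 𝟙 (congruent? m y z)) m ⟩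
      (∑[ z ∈ points n (suc d) ] 𝟙 (congruent? m y z)) * m ^ suc d
        ≤⟨ congruence-class-size m∣n y ⟩
      n ^ suc d ∎
-- Energies

-- The bridge from dot products to linear congruences; the trailing zero is the constant c of
-- `linear-solutions`.
dot-≡⇒∣ : ∀ {n d} .{{_ : NonZero n}} (y z x : Point n d) → dot y x ≡ dot z x →
          + n ℤ.∣ linear (differences y z) x ℤ.+ + 0
dot-≡⇒∣ {n} y z x eq = subst (+ n ℤ.∣_) (expand y z x) (%-≡⇒∣- (dotℕ y x) (dotℕ z x)
  -- `_mod_` is built with `fromℕ<`, so `toℕ` of a dot product is the remainder of the sum of
  -- products in ℕ.
  (trans (sym (Fin.toℕ-fromℕ< _)) (trans (cong toℕ eq) (Fin.toℕ-fromℕ< _))))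
  where
  dotℕ : ∀ {d} → Point n d → Point n d → ℕ
  dotℕ y x = Vec.sum (zipWith (λ a b → toℕ a * toℕ b) y x)
  distrib : ∀ a b c u v → (a ℤ.* c ℤ.+ u) ℤ.- (b ℤ.* c ℤ.+ v) ≡ (a ℤ.- b) ℤ.* c ℤ.+ (u ℤ.- v)
  distrib = ℤ.solve-∀
  expand : ∀ {d} (y z x : Point n d) → + dotℕ y x ℤ.- + dotℕ z x ≡ linear (differences y z) x ℤ.+ + 0
  expand []       []       []       = refl
  expand (a ∷ y) (b ∷ z) (c ∷ x) = begin
    (+ (toℕ a * toℕ c) ℤ.+ + dotℕ y x) ℤ.- (+ (toℕ b * toℕ c) ℤ.+ + dotℕ z x)
      ≡⟨ cong₂ (λ u v → (u ℤ.+ + dotℕ y x) ℤ.- (v ℤ.+ + dotℕ z x)) (ℤ.pos-* (toℕ a) (toℕ c)) (ℤ.pos-* (toℕ b) (toℕ c)) ⟩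
    (+ toℕ a ℤ.* + toℕ c ℤ.+ + dotℕ y x) ℤ.- (+ toℕ b ℤ.* + toℕ c ℤ.+ + dotℕ z x)
      ≡⟨ distrib (+ toℕ a) (+ toℕ b) (+ toℕ c) (+ dotℕ y x) (+ dotℕ z x) ⟩
    (+ toℕ a ℤ.- + toℕ b) ℤ.* + toℕ c ℤ.+ (+ dotℕ y x ℤ.- + dotℕ z x)
      ≡⟨ cong (λ s → (+ toℕ a ℤ.- + toℕ b) ℤ.* + toℕ c ℤ.+ s) (expand y z x) ⟩
    (+ toℕ a ℤ.- + toℕ b) ℤ.* + toℕ c ℤ.+ (linear (differences y z) x ℤ.+ + 0)
      ≡⟨ ℤ.+-assoc ((+ toℕ a ℤ.- + toℕ b) ℤ.* + toℕ c) (linear (differences y z) x) (+ 0) ⟨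
    linear (differences (a ∷ y) (b ∷ z)) (c ∷ x) ℤ.+ + 0 ∎
    where open ≡-Reasoning

module _ {n d : ℕ} .{{_ : NonZero n}} where

  fiber : Point n d → Fin n → List (Point n d) → List (Point n d)
  fiber x t F = filter (λ y → dot y x Fin.≟ t) F

  -- The number of pairs (y , z) in F × F with dot y x ≡ dot z x for all x in X.
  energy : ∀ {k} → Vec (Point n d) k → List (Point n d) → ℕ
  energy []      F = length F * length F
  energy (x ∷ X) F = ∑[ t ∈ allFin n ] energy X (fiber x t F)

  energy₁ : Point n d → List (Point n d) → ℕ
  energy₁ x = energy (x ∷ [])

  -- The square of the size of a fiber counts the pairs inside it, and a pair shares at most one
  -- fiber, which it does only if its two products with x agree.
  energy₁≤pairs : ∀ x F → energy₁ x F ≤ ∑[ y ∈ F ] ∑[ z ∈ F ] 𝟙 (dot y x Fin.≟ dot z x)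
  energy₁≤pairs x F = begin
    ∑[ t ∈ allFin n ] length (fiber x t F) * length (fiber x t F)
      ≡⟨ ∑-cong (allFin n) (λ t → trans (cong (λ l → l * l) (length-filter-∑ (λ y → dot y x Fin.≟ t) F)) (∑-*-∑ F F _ _)) ⟩
    ∑[ t ∈ allFin n ] ∑[ y ∈ F ] ∑[ z ∈ F ] 𝟙 (dot y x Fin.≟ t) * 𝟙 (dot z x Fin.≟ t)
      ≡⟨ ∑-swap (allFin n) F _ ⟩
    ∑[ y ∈ F ] ∑[ t ∈ allFin n ] ∑[ z ∈ F ] 𝟙 (dot y x Fin.≟ t) * 𝟙 (dot z x Fin.≟ t)
      ≡⟨ ∑-cong F (λ y → ∑-swap (allFin n) F _) ⟩
    ∑[ y ∈ F ] ∑[ z ∈ F ] ∑[ t ∈ allFin n ] 𝟙 (dot y x Fin.≟ t) * 𝟙 (dot z x Fin.≟ t)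
      ≤⟨ ∑-mono F (λ y → ∑-mono F λ z → collide (dot y x) (dot z x)) ⟩
    ∑[ y ∈ F ] ∑[ z ∈ F ] 𝟙 (dot y x Fin.≟ dot z x) ∎
    where
    open ≤-Reasoning
    collide : ∀ a b → ∑[ t ∈ allFin n ] 𝟙 (a Fin.≟ t) * 𝟙 (b Fin.≟ t) ≤ 𝟙 (a Fin.≟ b)
    collide a b with a Fin.≟ b
    ... | yes _   = ≤-trans
      (≤-reflexive (∑-cong (allFin n) (λ t → 𝟙-* (a Fin.≟ t) (b Fin.≟ t))))
      (∑𝟙-≤1 (λ t → (a Fin.≟ t) ×-dec (b Fin.≟ t)) (allFin⁺ n) (λ p q → trans (sym (proj₁ p)) (proj₁ q)))
    ... | no a≢b = ≤-reflexive (trans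
      (∑-cong (allFin n) (λ t → 𝟙-* (a Fin.≟ t) (b Fin.≟ t)))
      (∑𝟙-none (λ t → (a Fin.≟ t) ×-dec (b Fin.≟ t)) (allFin n) (λ _ p → a≢b (trans (proj₁ p) (sym (proj₂ p))))))

  -- The condition on x is one linear congruence modulo n whose coefficients are the coordinates of
  -- y - z, so `linear-solutions` applies with constant 0.
  equal-dots-≤ : ∀ (y z : Point n d) → (∑[ x ∈ points n d ] 𝟙 (dot y x Fin.≟ dot z x)) * n ≤ n ^ d * gcds n (differences y z)
  equal-dots-≤ y z = begin
    (∑[ x ∈ points n d ] 𝟙 (dot y x Fin.≟ dot z x)) * n
      ≤⟨ *-monoˡ-≤ n (∑-mono (points n d) (λ x → 𝟙-mono (dot y x Fin.≟ dot z x) (+ n ℤ.∣? (linear (differences y z) x ℤ.+ + 0)) (dot-≡⇒∣ y z x))) ⟩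
    (∑[ x ∈ points n d ] 𝟙 (+ n ℤ.∣? (linear (differences y z) x ℤ.+ + 0))) * n
      ≤⟨ linear-solutions ∣-refl (differences y z) (+ 0) ⟩
    𝟙 (+ gcds n (differences y z) ℤ.∣? + 0) * (n ^ d * gcds n (differences y z))
      ≤⟨ *-monoˡ-≤ _ (𝟙-≤1 (+ gcds n (differences y z) ℤ.∣? + 0)) ⟩
    1 * (n ^ d * gcds n (differences y z))
      ≡⟨ *-identityˡ _ ⟩
    n ^ d * gcds n (differences y z) ∎
    where open ≤-Reasoning

  ∑-fiber : ∀ x F → ∑[ t ∈ allFin n ] length (fiber x t F) ≡ length F
  ∑-fiber x F = begin
    ∑[ t ∈ allFin n ] length (fiber x t F)
      ≡⟨ ∑-cong (allFin n) (λ t → length-filter-∑ (λ y → dot y x Fin.≟ t) F) ⟩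
    ∑[ t ∈ allFin n ] ∑[ y ∈ F ] 𝟙 (dot y x Fin.≟ t)
      ≡⟨ ∑-swap (allFin n) F _ ⟩
    ∑[ y ∈ F ] ∑[ t ∈ allFin n ] 𝟙 (dot y x Fin.≟ t)
      ≡⟨ ∑-cong F (λ y → exactly-one (dot y x)) ⟩
    ∑[ y ∈ F ] 1
      ≡⟨ ∑-1 F ⟩
    length F ∎
    where
    open ≡-Reasoning
    exactly-one : ∀ a → ∑[ t ∈ allFin n ] 𝟙 (a Fin.≟ t) ≡ 1
    exactly-one a = ≤-antisym
      (∑𝟙-≤1 (a Fin.≟_) (allFin⁺ n) (λ p q → trans (sym p) q))
      (≤-trans (≤-reflexive (sym (𝟙-yes (a Fin.≟ a) refl))) (∑-∈ (λ t → 𝟙 (a Fin.≟ t)) (∈-allFin a)))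

-- Bounds for energies summed over points and over tuples

module _ {n d : ℕ} .{{_ : NonZero n}} where

  private
    -- The dimension is `suc d`, so `N` is the number of all points and `G` is γ(n) to the dimension
    -- minus one, the power in the hypothesis of the theorem.
    N G : ℕ
    N = n ^ suc d
    G = γ n ^ d

  -- Summing over x first leaves a gcd for every pair (y , z), and `∑-gcds-≤` sums these gcds over z
  -- for each fixed y.
  total-energy₁-≤ : ∀ {F : List (Point n (suc d))} → Unique F →
    G * (∑[ x ∈ points n (suc d) ] n * energy₁ x F) ≤ N * (length F * (G * length F + τ n * N))
  total-energy₁-≤ {F} u = begin
    G * (∑[ x ∈ P ] n * energy₁ x F)
      ≡⟨ cong (G *_) (trans (∑-*ˡ n P _) (*-comm n _)) ⟩
    G * ((∑[ x ∈ P ] energy₁ x F) * n)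
      ≤⟨ *-monoʳ-≤ G (*-monoˡ-≤ n (∑-mono P (λ x → energy₁≤pairs x F))) ⟩
    G * ((∑[ x ∈ P ] ∑[ y ∈ F ] ∑[ z ∈ F ] 𝟙 (dot y x Fin.≟ dot z x)) * n)
      ≡⟨ cong (λ s → G * (s * n)) (trans (∑-swap P F _) (∑-cong F λ y → ∑-swap P F _)) ⟩
    G * ((∑[ y ∈ F ] ∑[ z ∈ F ] ∑[ x ∈ P ] 𝟙 (dot y x Fin.≟ dot z x)) * n)
      ≡⟨ cong (G *_) (trans (sym (∑-*ʳ n F _)) (∑-cong F λ y → sym (∑-*ʳ n F _))) ⟩
    G * (∑[ y ∈ F ] ∑[ z ∈ F ] (∑[ x ∈ P ] 𝟙 (dot y x Fin.≟ dot z x)) * n)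
      ≤⟨ *-monoʳ-≤ G (∑-mono F λ y → ∑-mono F λ z → equal-dots-≤ y z) ⟩
    G * (∑[ y ∈ F ] ∑[ z ∈ F ] N * gcds n (differences y z))
      ≡⟨ cong (G *_) (trans (∑-cong F λ y → ∑-*ˡ N F _) (∑-*ˡ N F _)) ⟩
    G * (N * (∑[ y ∈ F ] ∑[ z ∈ F ] gcds n (differences y z)))
      ≡⟨ swap-* G N _ ⟩
    N * (G * (∑[ y ∈ F ] ∑[ z ∈ F ] gcds n (differences y z)))
      ≡⟨ cong (N *_) (∑-*ˡ G F _) ⟨
    N * (∑[ y ∈ F ] G * (∑[ z ∈ F ] gcds n (differences y z)))
      ≤⟨ *-monoʳ-≤ N (∑-mono F (λ y → ∑-gcds-≤ u y)) ⟩
    N * ∑ F (λ _ → G * length F + τ n * N)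
      ≡⟨ cong (N *_) (∑-const F _) ⟩
    N * (length F * (G * length F + τ n * N)) ∎
    where
    open ≤-Reasoning
    P = points n (suc d)
    swap-* : ∀ p q r → p * (q * r) ≡ q * (p * r)
    swap-* = solve-∀

  -- Cauchy-Schwarz over the n fibers of F.
  length²≤energy₁ : ∀ x (F : List (Point n (suc d))) → length F * length F ≤ n * energy₁ x F
  length²≤energy₁ x F = begin
    length F * length F
      ≡⟨ cong₂ _*_ (∑-fiber x F) (∑-fiber x F) ⟨
    (∑[ t ∈ allFin n ] length (fiber x t F)) * (∑[ t ∈ allFin n ] length (fiber x t F))
      ≤⟨ ∑-cauchy-schwarz (allFin n) _ (λ _ → 1) _ (λ t → ≤-reflexive (sym (*-identityˡ _))) ⟩
    ∑ (allFin n) (λ _ → 1) * energy₁ x F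
      ≡⟨ cong (_* energy₁ x F) (trans (∑-1 (allFin n)) (length-tabulate {n = n} (λ i → i))) ⟩
    n * energy₁ x F ∎
    where open ≤-Reasoning

  -- The excess n * energy₁ x F ∸ length F ^ 2 is nonnegative, so its sum over E is
  -- at most its sum over all points, where the main terms cancel.
  ∑-energy₁-≤ : ∀ {E F : List (Point n (suc d))} → Unique E → Unique F →
    G * (n * (∑[ x ∈ E ] energy₁ x F)) ≤ G * (length E * (length F * length F)) + length F * (τ n * (N * N))
  ∑-energy₁-≤ {E} {F} uE uF = begin
    G * (n * (∑[ x ∈ E ] energy₁ x F))
      ≡⟨ cong (G *_) (split E) ⟩
    G * (length E * f² + ∑ E excess)
      ≡⟨ *-distribˡ-+ G (length E * f²) _ ⟩
    G * (length E * f²) + G * ∑ E excess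
      ≤⟨ +-monoʳ-≤ (G * (length E * f²)) (≤-trans (*-monoʳ-≤ G (∑-≤-points excess uE)) total-excess) ⟩
    G * (length E * f²) + length F * (τ n * (N * N)) ∎
    where
    open ≤-Reasoning
    P = points n (suc d)
    f² = length F * length F
    excess : Point n (suc d) → ℕ
    excess x = n * energy₁ x F ∸ f²
    split : ∀ A → n * (∑[ x ∈ A ] energy₁ x F) ≡ length A * f² + ∑ A excess
    split A = begin-equality
      n * (∑[ x ∈ A ] energy₁ x F)       ≡⟨ ∑-*ˡ n A _ ⟨
      ∑[ x ∈ A ] n * energy₁ x F         ≡⟨ ∑-cong A (λ x → m+[n∸m]≡n (length²≤energy₁ x F)) ⟨
      ∑[ x ∈ A ] (f² + excess x)          ≡⟨ ∑-+ A (λ _ → f²) excess ⟩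
      ∑ A (λ _ → f²) + ∑ A excess        ≡⟨ cong (_+ ∑ A excess) (∑-const A f²) ⟩
      length A * f² + ∑ A excess          ∎
    length-P : length P ≡ N
    length-P = trans (length-vecs (allFin n) (suc d)) (cong (_^ suc d) (length-tabulate {n = n} (λ i → i)))
    expand : ∀ G N f t → N * (f * (G * f + t * N)) ≡ G * (N * (f * f)) + f * (t * (N * N))
    expand = solve-∀
    total-excess : G * ∑ P excess ≤ length F * (τ n * (N * N))
    total-excess = +-cancelˡ-≤ (G * (N * f²)) _ _ (begin
      G * (N * f²) + G * ∑ P excess               ≡⟨ *-distribˡ-+ G (N * f²) _ ⟨
      G * (N * f² + ∑ P excess)                   ≡⟨ cong (λ l → G * (l * f² + ∑ P excess)) length-P ⟨
      G * (length P * f² + ∑ P excess)            ≡⟨ cong (G *_) (trans (sym (split P)) (sym (∑-*ˡ n P _))) ⟩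
      G * (∑[ x ∈ P ] n * energy₁ x F)            ≤⟨ total-energy₁-≤ uF ⟩
      N * (length F * (G * length F + τ n * N))    ≡⟨ expand G N (length F) (τ n) ⟩
      G * (N * f²) + length F * (τ n * (N * N))   ∎)

  -- `F` is kept apart from `E` because the induction replaces it by fibers while the tuples still
  -- run over E^k.
  total-energy : List (Point n (suc d)) → ℕ → List (Point n (suc d)) → ℕ
  total-energy E k F = ∑[ X ∈ vecs E k ] energy X F

  total-energy-suc : ∀ E k F →
    total-energy E (suc k) F ≡ ∑[ x ∈ E ] ∑[ t ∈ allFin n ] total-energy E k (fiber x t F)
  total-energy-suc E k F = trans (∑-vecs-suc E k _) (∑-cong E λ x → ∑-swap (vecs E k) (allFin n) _)

  private
    -- This is τ(n)N²/n: the error per point of F in `∑-energy₁-≤`, with one factor n taken out.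
    K : ℕ
    K = τ n * (n ^ d * N)

  -- Induction on k, splitting F into its fibers over the first entry x of the tuple. The quadratic
  -- terms of the fibers add up to `energy₁ x F`, which `∑-energy₁-≤` controls after summing over x;
  -- the error is linear in the size of F, so over the fibers of x it adds up to the same expression
  -- for F.
  total-energy-≤ : ∀ {E} → Unique E → ∀ k {F} → Unique F →
    length E * G * n ^ k * total-energy E k F ≤
    length E ^ k * (length E * G * (length F * length F) + length F * (k * (K * n ^ k)))
  total-energy-≤ {E} uE zero {F} uF = ≤-reflexive (simplify (length E * G) (length F))
    where
    simplify : ∀ c f → c * 1 * (f * f + 0) ≡ 1 * (c * (f * f) + f * 0)
    simplify = solve-∀
  total-energy-≤ {E} uE (suc k) {F} uF = begin
    e * G * (n * n ^ k) * total-energy E (suc k) F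
      ≡⟨ regroup₁ (e * G) n (n ^ k) (total-energy E (suc k) F) ⟩
    n * (e * G * n ^ k * total-energy E (suc k) F)
      ≡⟨ cong (λ s → n * (e * G * n ^ k * s)) (total-energy-suc E k F) ⟩
    n * (e * G * n ^ k * (∑[ x ∈ E ] ∑[ t ∈ allFin n ] total-energy E k (fiber x t F)))
      ≡⟨ cong (n *_) (trans (∑-cong E (λ x → ∑-*ˡ (e * G * n ^ k) (allFin n) _)) (∑-*ˡ (e * G * n ^ k) E _)) ⟨
    n * (∑[ x ∈ E ] ∑[ t ∈ allFin n ] e * G * n ^ k * total-energy E k (fiber x t F))
      ≤⟨ *-monoʳ-≤ n (∑-mono E λ x → ∑-mono (allFin n) λ t →
           total-energy-≤ uE k (Unique.filter⁺ (λ y → dot y x Fin.≟ t) uF)) ⟩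
    n * (∑[ x ∈ E ] ∑[ t ∈ allFin n ] e ^ k * (e * G * (size x t * size x t) + size x t * c))
      ≡⟨ cong (n *_) (trans (∑-cong E ∑-bound) (∑-*ˡ (e ^ k) E _)) ⟩
    n * (e ^ k * (∑[ x ∈ E ] (e * G * energy₁ x F + f * c)))
      ≡⟨ cong (λ s → n * (e ^ k * s)) (trans (∑-+ E _ _) (cong₂ _+_ (∑-*ˡ (e * G) E _) (∑-const E (f * c)))) ⟩
    n * (e ^ k * (e * G * (∑[ x ∈ E ] energy₁ x F) + e * (f * c)))
      ≡⟨ regroup₂ n (e ^ k) e G (∑[ x ∈ E ] energy₁ x F) (f * c) ⟩
    e ^ suc k * (G * (n * (∑[ x ∈ E ] energy₁ x F)) + n * (f * c))
      ≤⟨ *-monoʳ-≤ (e ^ suc k) (+-monoˡ-≤ (n * (f * c)) (∑-energy₁-≤ uE uF)) ⟩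
    e ^ suc k * (G * (e * (f * f)) + f * (τ n * (N * N)) + n * (f * c))
      ≡⟨ cong (e ^ suc k *_) (regroup₃ G e f (τ n) (n ^ d) N n k (n ^ k)) ⟩
    e ^ suc k * (e * G * (f * f) + f * (K * (n * 1) + k * (K * n ^ suc k)))
      -- The fresh error K n is rounded up to K n^(k+1), so that it becomes one more copy of the k
      -- errors already present.
      ≤⟨ *-monoʳ-≤ (e ^ suc k) (+-monoʳ-≤ (e * G * (f * f)) (*-monoʳ-≤ f
           (+-monoˡ-≤ (k * (K * n ^ suc k)) (*-monoʳ-≤ K (*-monoʳ-≤ n (m^n>0 n k)))))) ⟩
    e ^ suc k * (e * G * (f * f) + f * (suc k * (K * n ^ suc k))) ∎
    where
    open ≤-Reasoning
    e = length E
    f = length F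
    c = k * (K * n ^ k)
    size : Point n (suc d) → Fin n → ℕ
    size x t = length (fiber x t F)
    regroup₁ : ∀ a n p m → a * (n * p) * m ≡ n * (a * p * m)
    regroup₁ = solve-∀
    regroup₂ : ∀ n p e G s u → n * (p * (e * G * s + e * u)) ≡ e * p * (G * (n * s) + n * u)
    regroup₂ = solve-∀
    regroup₃ : ∀ G e f t p N n k q →
      G * (e * (f * f)) + f * (t * (n * p * N)) + n * (f * (k * (t * (p * N) * q))) ≡
      e * G * (f * f) + f * (t * (p * N) * (n * 1) + k * (t * (p * N) * (n * q)))
    regroup₃ = solve-∀
    ∑-bound : ∀ x → ∑[ t ∈ allFin n ] e ^ k * (e * G * (size x t * size x t) + size x t * c) ≡
                    e ^ k * (e * G * energy₁ x F + f * c)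
    ∑-bound x = begin-equality
      ∑[ t ∈ allFin n ] e ^ k * (e * G * (size x t * size x t) + size x t * c)
        ≡⟨ ∑-*ˡ (e ^ k) (allFin n) _ ⟩
      e ^ k * (∑[ t ∈ allFin n ] (e * G * (size x t * size x t) + size x t * c))
        ≡⟨ cong (e ^ k *_) (∑-+ (allFin n) _ _) ⟩
      e ^ k * ((∑[ t ∈ allFin n ] e * G * (size x t * size x t)) + (∑[ t ∈ allFin n ] size x t * c))
        ≡⟨ cong (e ^ k *_) (cong₂ _+_ (∑-*ˡ (e * G) (allFin n) _)
             (trans (∑-*ʳ c (allFin n) _) (cong (_* c) (∑-fiber x F)))) ⟩
      e ^ k * (e * G * energy₁ x F + f * c) ∎

  -- For F = E the size hypothesis makes the error at most the main term, whence the factor 2.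
  total-energy-≤′ : ∀ {E} → Unique E → ∀ {k A} → k ≤ A → .{{_ : NonZero (length E ^ 2 * G)}} →
    A * (K * n ^ k) ≤ length E ^ 2 * G → n ^ k * total-energy E k E ≤ 2 * length E ^ (k + 2)
  total-energy-≤′ {E} uE {k} {A} k≤A large = *-cancelˡ-≤ (e ^ 2 * G) (begin
    e ^ 2 * G * (n ^ k * M)                             ≡⟨ regroup₁ e G (n ^ k) M ⟩
    e * (e * G * n ^ k * M)                             ≤⟨ *-monoʳ-≤ e (total-energy-≤ uE k uE) ⟩
    e * (e ^ k * (e * G * (e * e) + e * (k * (K * n ^ k))))
      ≤⟨ *-monoʳ-≤ e (*-monoʳ-≤ (e ^ k) (+-monoʳ-≤ (e * G * (e * e)) (*-monoʳ-≤ e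
           (≤-trans (*-monoˡ-≤ (K * n ^ k) k≤A) large)))) ⟩
    e * (e ^ k * (e * G * (e * e) + e * (e ^ 2 * G)))   ≡⟨ regroup₂ e G (e ^ k) ⟩
    e ^ 2 * G * (2 * (e ^ k * e ^ 2))                   ≡⟨ cong (λ s → e ^ 2 * G * (2 * s)) (^-distribˡ-+-* e k 2) ⟨
    e ^ 2 * G * (2 * e ^ (k + 2))                       ∎)
    where
    open ≤-Reasoning
    e = length E
    M = total-energy E k E
    regroup₁ : ∀ e G p M → e * (e * 1) * G * (p * M) ≡ e * (e * G * p * M)
    regroup₁ = solve-∀
    regroup₂ : ∀ e G p → e * (p * (e * G * (e * e) + e * (e * (e * 1) * G))) ≡ e * (e * 1) * G * (2 * (p * (e * (e * 1))))
    regroup₂ = solve-∀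
-- Counting simplex types

concatMap-AllPairs : ∀ {a b q r} {A : Set a} {B : Set b} {Q : A → A → Set q} {R : B → B → Set r}
  (f : A → List B) {xs} → AllPairs Q xs → (∀ x → AllPairs R (f x)) →
  (∀ {x y u v} → Q x y → u ∈ f x → v ∈ f y → R u v) → AllPairs R (concatMap f xs)
concatMap-AllPairs f xs! inside across = AllPairs.concat⁺
  (All.map⁺ (All.tabulate (λ {x} _ → inside x)))
  (AllPairs.map⁺ (AllPairs.map (λ q → All.tabulate (λ u∈ → All.tabulate (λ v∈ → across q u∈ v∈))) xs!))

-- A new vertex is joined to the k old ones by k new edges; this is the exponent gained in each step
-- of `many-types`.
suc-C-2 : ∀ k → suc k C 2 ≡ k + k C 2
suc-C-2 k = begin
  suc k C 2     ≡⟨ nCk+nC[k+1]≡[n+1]C[k+1] k 1 ⟨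
  k C 1 + k C 2 ≡⟨ cong (_+ k C 2) (nC1≡n k) ⟩
  k + k C 2     ∎
  where open ≡-Reasoning

-- A set of (k+1)-tuples of density 1/q has, over at least e^k / 2q of the k-tuples X,
-- at least n^k / 8q² star types, hence the recursion.
proportion : ℕ → ℕ → ℕ
proportion zero    q = 1
proportion (suc k) q = 8 * (q * q) * proportion k (2 * q)

module _ {n d : ℕ} .{{_ : NonZero n}} where

  SameStar : ∀ {k} → Vec (Point n d) k → Point n d → Point n d → Set
  SameStar X y z = ∀ i → dot y (Vec.lookup X i) ≡ dot z (Vec.lookup X i)

  -- Only i < j is compared, since a simplex type records no product of a vertex with itself.
  SameType : ∀ {k} (X Y : Vec (Point n d) k) → Set
  SameType X Y = ∀ {i j} → i Fin.< j →
    dot (Vec.lookup X i) (Vec.lookup X j) ≡ dot (Vec.lookup Y i) (Vec.lookup Y j)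

  -- One point is picked from every nonempty class of points of F with the same products with all of
  -- X, so the length is the number of stars seen from F.
  star-representatives : ∀ {k} → Vec (Point n d) k → List (Point n d) → List (Point n d)
  star-representatives []      F = take 1 F
  star-representatives (x ∷ X) F = concatMap (λ t → star-representatives X (fiber x t F)) (allFin n)

  ∈-star-representatives⁻ : ∀ {k} (X : Vec (Point n d) k) {F y} → y ∈ star-representatives X F → y ∈ F
  ∈-star-representatives⁻ []      {z ∷ F} (here y≡z) = here y≡z
  ∈-star-representatives⁻ (x ∷ X) {F}     y∈ with
    t , y∈t ← Any.satisfied (∈-concatMap⁻ (λ t → star-representatives X (fiber x t F)) {xs = allFin n} y∈) =
    proj₁ (∈-filter⁻ (λ y → dot y x Fin.≟ t) {xs = F} (∈-star-representatives⁻ X y∈t))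

  -- Representatives from one fiber of x are separated by the remaining entries of X, those from
  -- different fibers by their products with x.
  star-representatives-distinct : ∀ {k} (X : Vec (Point n d) k) F →
    AllPairs (λ y z → ¬ SameStar X y z) (star-representatives X F)
  star-representatives-distinct []      []      = []
  star-representatives-distinct []      (y ∷ F) = [] ∷ []
  star-representatives-distinct (x ∷ X) F       =
    concatMap-AllPairs (λ t → star-representatives X (fiber x t F)) (allFin⁺ n)
      (λ t → AllPairs.map (λ distinct same → distinct (same ∘ suc))
               (star-representatives-distinct X (fiber x t F)))
      (λ {s} {t} s≢t u∈ v∈ same → s≢t (trans (sym (value s u∈)) (trans (same zero) (value t v∈))))
    where
    value : ∀ t {u} → u ∈ star-representatives X (fiber x t F) → dot u x ≡ t
    value t u∈ = proj₂ (∈-filter⁻ (λ y → dot y x Fin.≟ t) {xs = F} (∈-star-representatives⁻ X u∈))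

  -- Cauchy-Schwarz over the fibers at each level of the recursion, weighted by the representatives
  -- and the energies of the fibers.
  length²≤representatives*energy : ∀ {k} (X : Vec (Point n d) k) F →
    length F * length F ≤ length (star-representatives X F) * energy X F
  length²≤representatives*energy []      []        = z≤n
  length²≤representatives*energy []      F@(_ ∷ _) = ≤-reflexive (sym (*-identityˡ (length F * length F)))
  length²≤representatives*energy (x ∷ X) F         = begin
    length F * length F
      ≡⟨ cong₂ _*_ (∑-fiber x F) (∑-fiber x F) ⟨
    (∑[ t ∈ allFin n ] length (fiber x t F)) * (∑[ t ∈ allFin n ] length (fiber x t F))
      ≤⟨ ∑-cauchy-schwarz (allFin n) _ _ _ (λ t → length²≤representatives*energy X (fiber x t F)) ⟩
    (∑[ t ∈ allFin n ] length (star-representatives X (fiber x t F))) * energy (x ∷ X) F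
      ≡⟨ cong (_* energy (x ∷ X) F) (length-concatMap (λ t → star-representatives X (fiber x t F)) (allFin n)) ⟨
    length (star-representatives (x ∷ X) F) * energy (x ∷ X) F ∎
    where open ≤-Reasoning

  energy-mono : ∀ {k} (X : Vec (Point n d) k) {F F′} → F ⊆ F′ → energy X F ≤ energy X F′
  energy-mono []      F⊆F′ = *-mono-≤ (⊆.length-mono-≤ F⊆F′) (⊆.length-mono-≤ F⊆F′)
  energy-mono (x ∷ X) F⊆F′ = ∑-mono (allFin n) (λ t →
    energy-mono X (⊆.filter⁺ (λ y → dot y x Fin.≟ t) (λ y → dot y x Fin.≟ t) (λ { refl p → p }) F⊆F′))

  module _ (E : List (Point n d)) .{{_ : NonZero (length E)}} where

    private
      e : ℕ
      e = length E

    -- If the stars of E were equidistributed, each of the e^k tuples would have energy e²/n^k; the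
    -- total may be at most twice what this predicts.
    EnergyBound : ℕ → Set
    EnergyBound k = n ^ k * (∑[ X ∈ vecs E k ] energy X E) ≤ 2 * e ^ (k + 2)

    module Extension {k} (q : ℕ) {S : Vec (Point n d) (suc k) → Set} (S? : ∀ X → Dec (S X)) where

      extensions : Vec (Point n d) k → List (Point n d)
      extensions X = filter (λ y → S? (y ∷ X)) E

      stars : Vec (Point n d) k → List (Point n d)
      stars X = star-representatives X (extensions X)

      -- The constant 8q² is chosen so that the poor tuples account for at most half of a set of
      -- (k+1)-tuples of density 1/q; see `many-rich`.
      Rich : Vec (Point n d) k → Set
      Rich X = n ^ k ≤ 8 * (q * q) * length (stars X)

      rich? : ∀ X → Dec (Rich X)
      rich? X = n ^ k ≤? 8 * (q * q) * length (stars X)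

      -- One bound for both cases, ready to be summed over X. A rich X gets the trivial bound of at
      -- most e extensions. A poor X has few stars, so Cauchy-Schwarz bounds the square of its
      -- number of extensions by stars times energy.
      extensions-bound : ∀ X → 8 * q * length (extensions X) * e ≤
                         (n ^ k * energy X E + 2 * (e * e)) + 8 * q * (e * e) * 𝟙 (rich? X)
      extensions-bound X = ≤-+-*𝟙 (rich? X) (λ _ → m≤n⇒m≤o+n _ rich-bound) poor-bound
        where
        open ≤-Reasoning
        s = length (extensions X)
        ε = energy X E
        T = length (stars X)
        rich-bound : 8 * q * s * e ≤ 8 * q * (e * e)
        rich-bound = ≤-trans (≤-reflexive (*-assoc (8 * q) s e))
          (*-monoʳ-≤ (8 * q) (*-monoˡ-≤ e (length-filter (λ y → S? (y ∷ X)) E)))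
        expand : ∀ q s e → 8 * q * s * e * (8 * q * s * e) ≡ 64 * (q * q * (e * e)) * (s * s)
        expand = solve-∀
        regroup₁ : ∀ q e T ε → 64 * (q * q * (e * e)) * (T * ε) ≡ 8 * (q * q) * T * (8 * (e * e) * ε)
        regroup₁ = solve-∀
        regroup₂ : ∀ e p ε → p * (8 * (e * e) * ε) ≡ 4 * (p * ε * (2 * (e * e)))
        regroup₂ = solve-∀
        poor-bound : ¬ Rich X → 8 * q * s * e ≤ n ^ k * ε + 2 * (e * e)
        -- AM-GM makes the bound linear in the energy. The partner 2e² is the bound that
        -- `EnergyBound` gives for the average of n^k ε.
        poor-bound poor = sq≤four-mul⇒≤+ (n ^ k * ε) (2 * (e * e)) (begin
          8 * q * s * e * (8 * q * s * e)          ≡⟨ expand q s e ⟩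
          64 * (q * q * (e * e)) * (s * s)         ≤⟨ *-monoʳ-≤ (64 * (q * q * (e * e)))
            (≤-trans (length²≤representatives*energy X (extensions X))
                     (*-monoʳ-≤ T (energy-mono X (⊆.filter-⊆ (λ y → S? (y ∷ X)) E)))) ⟩
          64 * (q * q * (e * e)) * (T * ε)         ≡⟨ regroup₁ q e T ε ⟩
          8 * (q * q) * T * (8 * (e * e) * ε)      ≤⟨ *-monoˡ-≤ (8 * (e * e) * ε) (<⇒≤ (≰⇒> poor)) ⟩
          n ^ k * (8 * (e * e) * ε)                ≡⟨ regroup₂ e (n ^ k) ε ⟩
          4 * (n ^ k * ε * (2 * (e * e)))          ∎)

      ∑-extensions : ∑[ X ∈ vecs E k ] length (extensions X) ≡ ∑[ X ∈ vecs E (suc k) ] 𝟙 (S? X)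
      ∑-extensions = trans (∑-cong (vecs E k) (λ X → length-filter-∑ (λ y → S? (y ∷ X)) E))
                    (trans (∑-swap (vecs E k) E _) (sym (∑-vecs-suc E k _)))

      -- Summing `extensions-bound` over all X gives at least 8e^(k+2) on the left by density, while
      -- the energies and the terms 2e² give at most 4e^(k+2) on the right. The rich tuples must
      -- supply the other half.
      many-rich : EnergyBound k → e ^ suc k ≤ q * (∑[ X ∈ vecs E (suc k) ] 𝟙 (S? X)) →
                  e ^ k ≤ 2 * q * (∑[ X ∈ vecs E k ] 𝟙 (rich? X))
      many-rich energy-bound dense = *-cancelˡ-≤ (4 * (e * e)) {{m*n≢0 4 (e * e) {{_}} {{m*n≢0 e e}}}}
        (+-cancelˡ-≤ (4 * (e * e) * e ^ k) _ _ (begin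
        4 * (e * e) * e ^ k + 4 * (e * e) * e ^ k
          ≡⟨ regroup₁ e (e ^ k) ⟩
        8 * e * e ^ suc k
          ≤⟨ *-monoʳ-≤ (8 * e) dense ⟩
        8 * e * (q * (∑[ X ∈ vecs E (suc k) ] 𝟙 (S? X)))
          ≡⟨ cong (λ s → 8 * e * (q * s)) ∑-extensions ⟨
        8 * e * (q * (∑[ X ∈ vecs E k ] length (extensions X)))
          ≡⟨ regroup₂ e q (∑[ X ∈ vecs E k ] length (extensions X)) ⟩
        8 * q * (∑[ X ∈ vecs E k ] length (extensions X)) * e
          ≡⟨ trans (∑-*ʳ e (vecs E k) _) (cong (_* e) (∑-*ˡ (8 * q) (vecs E k) _)) ⟨
        ∑[ X ∈ vecs E k ] 8 * q * length (extensions X) * e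
          ≤⟨ ∑-mono (vecs E k) extensions-bound ⟩
        ∑[ X ∈ vecs E k ] (n ^ k * energy X E + 2 * (e * e) + 8 * q * (e * e) * 𝟙 (rich? X))
          ≡⟨ trans (∑-+ (vecs E k) _ _) (cong₂ _+_
               (trans (∑-+ (vecs E k) _ _) (cong₂ _+_ (∑-*ˡ (n ^ k) (vecs E k) _)
                 (trans (∑-const (vecs E k) (2 * (e * e))) (cong (_* (2 * (e * e))) (length-vecs E k)))))
               (∑-*ˡ (8 * q * (e * e)) (vecs E k) _)) ⟩
        n ^ k * (∑[ X ∈ vecs E k ] energy X E) + e ^ k * (2 * (e * e)) + 8 * q * (e * e) * #rich
          ≤⟨ +-monoˡ-≤ _ (+-monoˡ-≤ _ energy-bound) ⟩
        2 * e ^ (k + 2) + e ^ k * (2 * (e * e)) + 8 * q * (e * e) * #rich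
          ≡⟨ cong (λ s → 2 * s + e ^ k * (2 * (e * e)) + 8 * q * (e * e) * #rich) (^-distribˡ-+-* e k 2) ⟩
        2 * (e ^ k * e ^ 2) + e ^ k * (2 * (e * e)) + 8 * q * (e * e) * #rich
          ≡⟨ regroup₃ e (e ^ k) q #rich ⟩
        4 * (e * e) * e ^ k + 4 * (e * e) * (2 * q * #rich) ∎))
        where
        open ≤-Reasoning
        #rich = ∑[ X ∈ vecs E k ] 𝟙 (rich? X)
        regroup₁ : ∀ e p → 4 * (e * e) * p + 4 * (e * e) * p ≡ 8 * e * (e * p)
        regroup₁ = solve-∀
        regroup₂ : ∀ e q s → 8 * e * (q * s) ≡ 8 * q * s * e
        regroup₂ = solve-∀
        regroup₃ : ∀ e p q r → 2 * (p * (e * (e * 1))) + p * (2 * (e * e)) + 8 * q * (e * e) * r ≡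
                               4 * (e * e) * p + 4 * (e * e) * (2 * q * r)
        regroup₃ = solve-∀

      extend : List (Vec (Point n d) k) → List (Vec (Point n d) (suc k))
      extend = concatMap (λ X → map (_∷ X) (stars X))

      extend-All : ∀ {L} → All (VecAll.All (_∈ E)) L → All (λ X → S X × VecAll.All (_∈ E) X) (extend L)
      extend-All []              = []
      extend-All {X ∷ _} (X⊆E ∷ L⊆E) = All.++⁺
        (All.map⁺ (All.tabulate (λ y∈ →
          let y∈E , Sy = ∈-filter⁻ (λ y → S? (y ∷ X)) {xs = E} (∈-star-representatives⁻ X y∈)
          in Sy , y∈E ∷ X⊆E)))
        (extend-All L⊆E)

      -- Since the new vertex has index `zero`, the pairs (zero , suc i) record its star and the
      -- pairs (suc i , suc j) the type of the old tuple. Equal types therefore force old tuples of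
      -- equal type, and over the same old tuple equal stars.
      extend-distinct : ∀ {L} → AllPairs (λ X Y → ¬ SameType X Y) L →
                        AllPairs (λ X Y → ¬ SameType X Y) (extend L)
      extend-distinct L! = concatMap-AllPairs (λ X → map (_∷ X) (stars X)) L!
        (λ X → AllPairs.map⁺ (AllPairs.map
          (λ distinct same → distinct (λ i → same {zero} {suc i} z<s))
          (star-representatives-distinct X (extensions X))))
        across
        where
        across : ∀ {X Y Z W} → ¬ SameType X Y → Z ∈ map (_∷ X) (stars X) → W ∈ map (_∷ Y) (stars Y) →
                 ¬ SameType Z W
        across {X} {Y} distinct Z∈ W∈ same with ∈-map⁻ (_∷ X) Z∈ | ∈-map⁻ (_∷ Y) W∈
        ... | _ , _ , refl | _ , _ , refl = distinct (λ {i} {j} i<j → same {suc i} {suc j} (s<s i<j))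

      length-extend : ∀ {L} → All Rich L → length L * n ^ k ≤ 8 * (q * q) * length (extend L)
      length-extend {[]}    []             = z≤n
      length-extend {X ∷ L} (rich ∷ L-rich) = begin
        n ^ k + length L * n ^ k
          ≤⟨ +-mono-≤ rich (length-extend L-rich) ⟩
        8 * (q * q) * length (stars X) + 8 * (q * q) * length (extend L)
          ≡⟨ *-distribˡ-+ (8 * (q * q)) (length (stars X)) _ ⟨
        8 * (q * q) * (length (stars X) + length (extend L))
          ≡⟨ cong (λ s → 8 * (q * q) * (s + length (extend L))) (length-map (_∷ X) (stars X)) ⟨
        8 * (q * q) * (length (map (_∷ X) (stars X)) + length (extend L))
          ≡⟨ cong (8 * (q * q) *_) (length-++ (map (_∷ X) (stars X))) ⟨
        8 * (q * q) * length (extend (X ∷ L)) ∎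
        where open ≤-Reasoning

    -- Induction on k with an arbitrary dense set `S`, because the next stage applies it to the set
    -- of rich k-tuples, whose density is at least 1/(2q) by `many-rich`. Each rich tuple found
    -- there is then extended by one point of every available star.
    many-types : ∀ k q {S : Vec (Point n d) k → Set} (S? : ∀ X → Dec (S X)) →
      (∀ {j} → j < k → EnergyBound j) → e ^ k ≤ q * (∑[ X ∈ vecs E k ] 𝟙 (S? X)) →
      Σ (List (Vec (Point n d) k)) λ L → All (λ X → S X × VecAll.All (_∈ E) X) L ×
        AllPairs (λ X Y → ¬ SameType X Y) L × n ^ (k C 2) ≤ proportion k q * length L
    many-types zero q S? _ dense with S? []
    ... | yes s  = ([] ∷ []) , ((s , []) ∷ []) , ([] ∷ []) , ≤-refl
    -- Without the empty tuple in `S`, the density hypothesis would read 1 ≤ q * 0.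
    ... | no ¬s  = contradiction (≤-trans dense (≤-reflexive (*-zeroʳ q))) λ ()
    many-types (suc k) q S? energy-bound dense =
      let L , L-rich , L-distinct , size = many-types k (2 * q) rich? (λ j<k → energy-bound (m<n⇒m<1+n j<k))
                                             (many-rich (energy-bound (n<1+n k)) dense)
      in extend L , extend-All (All.map proj₂ L-rich) , extend-distinct L-distinct , extend-size L-rich size
      where
      open ≤-Reasoning
      open Extension q S?
      c = proportion k (2 * q)
      regroup₁ : ∀ p c l → p * (c * l) ≡ c * (l * p)
      regroup₁ = solve-∀
      regroup₂ : ∀ c u l → c * (u * l) ≡ u * c * l
      regroup₂ = solve-∀
      extend-size : ∀ {L} → All (λ X → Rich X × VecAll.All (_∈ E) X) L → n ^ (k C 2) ≤ c * length L →
                    n ^ (suc k C 2) ≤ proportion (suc k) q * length (extend L)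
      extend-size {L} L-rich size = begin
        n ^ (suc k C 2)                       ≡⟨ cong (n ^_) (suc-C-2 k) ⟩
        n ^ (k + k C 2)                       ≡⟨ ^-distribˡ-+-* n k (k C 2) ⟩
        n ^ k * n ^ (k C 2)                   ≤⟨ *-monoʳ-≤ (n ^ k) size ⟩
        n ^ k * (c * length L)                ≡⟨ regroup₁ (n ^ k) c (length L) ⟩
        c * (length L * n ^ k)                ≤⟨ *-monoʳ-≤ c (length-extend (All.map proj₁ L-rich)) ⟩
        c * (8 * (q * q) * length (extend L)) ≡⟨ regroup₂ c (8 * (q * q)) (length (extend L)) ⟩
        8 * (q * q) * c * length (extend L)   ∎

-- From tuples to simplex types, and the choice of constants

module _ {n d : ℕ} .{{_ : NonZero n}} where

  typeOf : ∀ {k} → Vec (Point n d) (suc k) → SimplexType n k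
  typeOf {k} X = Vec.tabulate λ q →
    dot (Vec.lookup X (proj₁ (List.lookup (pairs k) q))) (Vec.lookup X (proj₂ (List.lookup (pairs k) q)))

  ∈-pairs : ∀ {k} {i j : Fin (suc k)} → i Fin.< j → (i , j) ∈ pairs k
  ∈-pairs i<j = ∈-filter⁺ (λ p → proj₁ p Fin.<? proj₂ p)
    (∈-cartesianProduct⁺ (∈-allFin _) (∈-allFin _)) i<j

  -- Every pair i < j occurs in `pairs k`, and the two types are compared at its position. Hence
  -- tuples that are distinct for `SameType` have different images under `typeOf`.
  typeOf-≡⇒SameType : ∀ {k} (X Y : Vec (Point n d) (suc k)) → typeOf X ≡ typeOf Y → SameType X Y
  typeOf-≡⇒SameType X Y eq {i} {j} i<j =
    subst (λ p → dot (Vec.lookup X (proj₁ p)) (Vec.lookup X (proj₂ p)) ≡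
                 dot (Vec.lookup Y (proj₁ p)) (Vec.lookup Y (proj₂ p)))
      (sym (Any.lookup-index (∈-pairs i<j)))
      (trans (sym (Vec.lookup∘tabulate _ q)) (trans (cong (λ t → Vec.lookup t q) eq) (Vec.lookup∘tabulate _ q)))
    where
    q = Any.index (∈-pairs i<j)

  typeOf-InP : ∀ {k E} (X : Vec (Point n d) (suc k)) → VecAll.All (_∈ E) X → InP k E (typeOf X)
  typeOf-InP X X⊆E = Vec.lookup X , (λ i → VecAll.lookup⁺ X⊆E i) , λ q → sym (Vec.lookup∘tabulate _ q)

τ-nonZero : ∀ n → .{{_ : NonZero n}} → NonZero (τ n)
τ-nonZero n = >-nonZero (nonempty (∈-divisors⁺ (1∣ n)))
  where
  nonempty : ∀ {xs : List ℕ} {x} → x ∈ xs → 0 < length xs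
  nonempty (here _)  = z<s
  nonempty (there _) = z<s

sq-nonZero⁻¹ : ∀ e m → .{{NonZero (e ^ 2 * m)}} → NonZero e
sq-nonZero⁻¹ (suc e) m = _

-- The size hypothesis is squared and multiplied out to avoid roots and division, so A is the square
-- of its constant; c is the reciprocal of the proportion of types obtained.
theorem2p6 : (d k : ℕ) → 1 ≤ d → 1 ≤ k → k ≤ d →
    Σ ℕ λ A → Σ ℕ λ N₀ → Σ ℕ λ c →
      (n : ℕ) → .{{_ : NonZero n}} → N₀ ≤ n → n % 2 ≡ 1 →
      (E : List (Point n d)) → Unique E →
      A * τ n * n ^ (2 * d + k ∸ 1) ≤ length E ^ 2 * γ n ^ (d ∸ 1) →
      Σ (List (SimplexType n k)) λ L →
        Unique L × All (InP k E) L × n ^ ((suc k) C 2) ≤ c * length L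
-- A = k pays for the at most k error terms in `total-energy-≤`. The dense set is all of E^(k+1), so
-- the density parameter starts at q = 1.
theorem2p6 (suc d) k@(suc _) _ _ _ = k , 0 , proportion (suc k) 1 , λ n _ _ E E! large →
  let
    K = τ n * (n ^ d * n ^ suc d)
    G = γ n ^ d
    large′ : k * (K * n ^ k) ≤ length E ^ 2 * G
    large′ = ≤-trans (≤-reflexive (exponents n (τ n) k)) large
    instance
      nonZero : NonZero (length E ^ 2 * G)
      -- The left side of the size hypothesis is positive, which makes E nonempty and the factor
      -- cancelled in `total-energy-≤′` nonzero.
      nonZero = >-nonZero (<-≤-trans (m*n>0 n) large)
      e≢0 : NonZero (length E)
      e≢0 = sq-nonZero⁻¹ (length E) G
    energy-bound : ∀ {j} → j < suc k → EnergyBound E j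
    -- The hypothesis for exponent k covers all shorter tuples, since n^j ≤ n^k.
    energy-bound {j} j<1+k = total-energy-≤′ E! {j} {k} (≤-pred j<1+k)
      (≤-trans (*-monoʳ-≤ k (*-monoʳ-≤ K (^-monoʳ-≤ n (≤-pred j<1+k)))) large′)
    L , L⊆E , L-distinct , size = many-types E (suc k) 1 {S = λ _ → ⊤} (λ _ → yes tt) energy-bound
      (≤-reflexive (sym (trans (*-identityˡ _) (trans (∑-1 (vecs E (suc k))) (length-vecs E (suc k))))))
  in map typeOf L
   , AllPairs.map⁺ (AllPairs.map (λ {X} {Y} distinct eq → distinct (typeOf-≡⇒SameType X Y eq)) L-distinct)
   , All.map⁺ (All.map (λ {X} X∈ → typeOf-InP X (proj₂ X∈)) L⊆E)
   , ≤-trans size (≤-reflexive (cong (proportion (suc k) 1 *_) (sym (length-map typeOf L))))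
  where
  exponents : ∀ n t k → k * (t * (n ^ d * n ^ suc d) * n ^ k) ≡ k * t * n ^ (2 * suc d + k ∸ 1)
  exponents n t k = begin
    k * (t * (n ^ d * n ^ suc d) * n ^ k)   ≡⟨ cong (λ s → k * (t * s * n ^ k)) (^-distribˡ-+-* n d (suc d)) ⟨
    k * (t * n ^ (d + suc d) * n ^ k)       ≡⟨ regroup k t (n ^ (d + suc d)) (n ^ k) ⟩
    k * t * (n ^ (d + suc d) * n ^ k)       ≡⟨ cong (k * t *_) (^-distribˡ-+-* n (d + suc d) k) ⟨
    -- The exponent `2 * suc d + k ∸ 1` computes to `d + suc (d + 0) + k`, so nothing is truncated
    -- and only `d + 0` has to be simplified.
    k * t * n ^ (d + suc d + k)             ≡⟨ cong (λ s → k * t * n ^ (d + suc s + k)) (+-identityʳ d) ⟨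
    k * t * n ^ (2 * suc d + k ∸ 1)         ∎
    where
    open ≡-Reasoning
    regroup : ∀ k t p q → k * (t * p * q) ≡ k * t * (p * q)
    regroup = solve-∀
  m*n>0 : ∀ n → .{{_ : NonZero n}} → 0 < k * τ n * n ^ (2 * suc d + k ∸ 1)
  m*n>0 n = >-nonZero⁻¹ _ {{m*n≢0 (k * τ n) (n ^ (2 * suc d + k ∸ 1))
    {{m*n≢0 k (τ n) {{_}} {{τ-nonZero n}}}} {{m^n≢0 n (2 * suc d + k ∸ 1)}}}}
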